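{- Let $R$ be a finite chain ring of length $2$ with residue field $\mathbb{F}_q$, and let $n$ be an integer with $q^2-q\le n\le q^2-2$. Then there exists a projective $(q^2n-2q,\,n)$-arc in $\mathrm{PHG}(2,R)$. Consequently, writing $n=q^2-q+t$ with $t\in\{0,1,\dots,q-2\}$, $$\mathrm{m}_n(R)\ge q(q+1)n-q^3+q(q-2-t).$$
   Context: Throughout, $R$ is a finite chain ring of nilpotency index (length) $2$, i.e. a finite local ring with radical $\mathrm{rad}R\neq 0$, $(\mathrm{rad}R)^2=0$, whose one-sided ideals form the chain $R\supsetneq\mathrm{rad}R\supsetneq 0$, with residue field $R/\mathrm{rad}R\cong\mathbb{F}_q$ ($q$ a prime power); then $|R|=q^2$. The projective Hjelmslev plane $\mathrm{PHG}(2,R)$ is the incidence structure whose points are the free rank-$1$ submodules of the right module $R_R^3$, whose lines are the free rank-$2$ submodules of $R_R^3$, with incidence given by inclusion; it has $q^4+q^3+q^2$ points and each line contains $q^2+q$ points. A $(k,n)$-arc is a map $\mathcal{K}$ from the point set to $\mathbb{N}_0$ with $\sum_x\mathcal{K}(x)=k$ and $\sum_{x\in L}\mathcal{K}(x)\le n$ for every line $L$; it is projective if $\mathcal{K}$ takes only values in $\{0,1\}$ (i.e. it is a set of $k$ points meeting every line in at most $n$ points). For $0\le n\le q^2+q$, $\mathrm{m}_n(R)$ denotes the largest $k$ such that a projective $(k,n)$-arc exists in $\mathrm{PHG}(2,R)$. -}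

module Defs where

open import Level using (Level; _⊔_) renaming (suc to lsuc)
open import Algebra.Bundles using (Ring; RawRing)
open import Algebra.Construct.Flip.Op using () renaming (ring to _ᵒᵖ)
open import Algebra.Module.Bundles using (RightModule)
import Algebra.Module.Construct.DirectProduct as DirectProduct
import Algebra.Module.Construct.TensorUnit as TensorUnit
open import Algebra.Properties.CommutativeMonoid.Sum using () renaming (sum to ∑)
open import Data.Fin using (Fin)
open import Data.List using (List; map)
import Data.List.Membership.Setoid as Membership
import Data.List.Relation.Unary.Unique.Setoid as Uniqueness
open import Data.Nat using (ℕ; _≤_)
open import Data.Nat.ListAction using (sum)
open import Data.Product using (∃; ∃-syntax; Σ-syntax; _×_)
open import Data.Sum using (_⊎_)
open import Function.Bundles using (Inverse; _⇔_)
open import Relation.Binary.Bundles using (Setoid)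
import Relation.Binary.Construct.On as On
open import Relation.Binary.Definitions using (_Respects_)
open import Relation.Binary.PropositionalEquality using (_≡_)
import Relation.Binary.PropositionalEquality.Properties as ≡
open import Relation.Unary using (Pred; Decidable; U; _∈_; _⊆_; _⊂_; _≐_)
open import Relation.Unary.Relation.Binary.Equality using (≐-setoid)

private
  variable
    a c ℓ p r ℓr m ℓm : Level

HasSize : Setoid a ℓ → ℕ → Set (a ⊔ ℓ)
HasSize S n = Inverse S (≡.setoid (Fin n))

record Submodule {R : Ring r ℓr} (M : RightModule R m ℓm) :
                 Set (m ⊔ lsuc (r ⊔ ℓm)) where
  open RightModule M
  field
    ⟦_⟧       : Pred Carrierᴹ (r ⊔ ℓm)
    respects  : ⟦_⟧ Respects _≈ᴹ_
    0-closed  : 0ᴹ ∈ ⟦_⟧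
    +-closed  : ∀ {u v} → u ∈ ⟦_⟧ → v ∈ ⟦_⟧ → u +ᴹ v ∈ ⟦_⟧
    *ᵣ-closed : ∀ {u} s → u ∈ ⟦_⟧ → u *ᵣ s ∈ ⟦_⟧

open Submodule public using (⟦_⟧)

module _ {R : Ring r ℓr} {M : RightModule R m ℓm} where

  open Ring R using (Carrier; _≈_; 0#)
  open RightModule M

  linearCombination : ∀ {n} → (Fin n → Carrierᴹ) → (Fin n → Carrier) → Carrierᴹ
  linearCombination e s = ∑ +ᴹ-commutativeMonoid (λ i → e i *ᵣ s i)

  record IsBasis (V : Submodule M) {n} (e : Fin n → Carrierᴹ) :
                 Set (r ⊔ ℓr ⊔ m ⊔ ℓm) where
    field
      members     : ∀ i → e i ∈ ⟦ V ⟧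
      generates   : ∀ {v} → v ∈ ⟦ V ⟧ → ∃[ s ] v ≈ᴹ linearCombination e s
      independent : ∀ s → linearCombination e s ≈ᴹ 0ᴹ → ∀ i → s i ≈ 0#

  IsFreeOfRank : ℕ → Submodule M → Set (r ⊔ ℓr ⊔ m ⊔ ℓm)
  IsFreeOfRank n V = ∃ λ (e : Fin n → Carrierᴹ) → IsBasis V e

RightIdeal : Ring c ℓ → Set (lsuc (c ⊔ ℓ))
RightIdeal R = Submodule (TensorUnit.rightModule {R = R})

-- Scalar multiplication in the regular right module of R ᵒᵖ is x *ᵣ s = s * x.
LeftIdeal : Ring c ℓ → Set (lsuc (c ⊔ ℓ))
LeftIdeal R = RightIdeal (R ᵒᵖ)

-- Classically every subset of a finite ring is decidable.  Constructively the
-- quantifiers over ideals below have to be restricted to decidable ones: for a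
-- proposition P, { x ∈ rad R ∣ x ≈ 0 or P } is an ideal, and requiring it to be
-- 0 or rad R would decide P.

module _ (R : Ring c ℓ) where

  open Ring R

  record IsMaximal (I : RightIdeal R) : Set (lsuc (c ⊔ ℓ)) where
    field
      decidable : Decidable ⟦ I ⟧
      proper    : ⟦ I ⟧ ⊂ U
      maximal   : ∀ (J : RightIdeal R) → Decidable ⟦ J ⟧ → ⟦ I ⟧ ⊆ ⟦ J ⟧ →
                  ⟦ J ⟧ ≐ ⟦ I ⟧ ⊎ ⟦ J ⟧ ≐ U

  -- The Jacobson radical.  Intersecting the maximal left ideals instead gives
  -- the same set.
  rad : Pred Carrier (lsuc (c ⊔ ℓ))
  rad x = ∀ (I : RightIdeal R) → IsMaximal I → x ∈ ⟦ I ⟧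

  record IsFiniteChainRingOfLength2 : Set (lsuc (c ⊔ ℓ)) where
    field
      finite     : ∃[ N ] HasSize setoid N
      local      : Σ[ I ∈ RightIdeal R ]
                     IsMaximal I × (∀ J → IsMaximal J → ⟦ J ⟧ ≐ ⟦ I ⟧)
      0⊂rad      : (_≈ 0#) ⊂ rad
      rad⊂R      : rad ⊂ U
      rad²≈0     : ∀ {x y} → x ∈ rad → y ∈ rad → x * y ≈ 0#
      rightChain : ∀ (I : RightIdeal R) → Decidable ⟦ I ⟧ →
                   ⟦ I ⟧ ≐ U ⊎ ⟦ I ⟧ ≐ rad ⊎ ⟦ I ⟧ ≐ (_≈ 0#)
      leftChain  : ∀ (I : LeftIdeal R) → Decidable ⟦ I ⟧ →
                   ⟦ I ⟧ ≐ U ⊎ ⟦ I ⟧ ≐ rad ⊎ ⟦ I ⟧ ≐ (_≈ 0#)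

  -- The elements of R, with x and y identified when x + rad R = y + rad R.
  R/rad : RawRing c (lsuc (c ⊔ ℓ))
  R/rad = record
    { _≈_ = λ x y → (x - y) ∈ rad
    ; _+_ = _+_
    ; _*_ = _*_
    ; -_  = -_
    ; 0#  = 0#
    ; 1#  = 1#
    }

module PHG (R : Ring c ℓ) where

  R³ : RightModule R c ℓ
  R³ = R₁ ×ₘ (R₁ ×ₘ R₁)
    where
    R₁   = TensorUnit.rightModule {R = R}
    _×ₘ_ = DirectProduct.rightModule

  record Point : Set (lsuc (c ⊔ ℓ)) where
    field
      submodule : Submodule R³
      free      : IsFreeOfRank 1 submodule

  record Line : Set (lsuc (c ⊔ ℓ)) where
    field
      submodule : Submodule R³
      free      : IsFreeOfRank 2 submodule

  _on_ : Point → Line → Set (c ⊔ ℓ)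
  x on L = ⟦ Point.submodule x ⟧ ⊆ ⟦ Line.submodule L ⟧

  pointSetoid : Setoid (lsuc (c ⊔ ℓ)) (c ⊔ ℓ)
  pointSetoid = On.setoid (≐-setoid _ (c ⊔ ℓ)) (λ x → ⟦ Point.submodule x ⟧)

  open Setoid pointSetoid using () renaming (_≈_ to _≈ₚ_)
  open Membership pointSetoid using () renaming (_∈_ to _∈ₗ_)
  open Uniqueness pointSetoid using (Unique)

  -- ΣK over the points satisfying P equals s.  The sum runs over a list in which
  -- each such point occurs exactly once up to _≈ₚ_; for K respecting _≈ₚ_ its
  -- value does not depend on the list.
  SumOver : Pred Point p → (Point → ℕ) → ℕ → Set (p ⊔ lsuc (c ⊔ ℓ))
  SumOver P K s = Σ[ xs ∈ List Point ]
    Unique xs × (∀ x → P x ⇔ (x ∈ₗ xs)) × sum (map K xs) ≡ s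

  record IsArc (k n : ℕ) (K : Point → ℕ) : Set (lsuc (c ⊔ ℓ)) where
    field
      respects : ∀ {x y} → x ≈ₚ y → K x ≡ K y
      total    : SumOver U K k
      secants  : ∀ L → ∃[ s ] SumOver (_on L) K s × s ≤ n

  IsProjective : (Point → ℕ) → Set (lsuc (c ⊔ ℓ))
  IsProjective K = ∀ x → K x ≡ 0 ⊎ K x ≡ 1

  HasProjectiveArc : ℕ → ℕ → Set (lsuc (c ⊔ ℓ))
  HasProjectiveArc k n = ∃[ K ] IsArc k n K × IsProjective K

  -- m is the number mₙ(R).
  IsMaxArcSize : ℕ → ℕ → Set (lsuc (c ⊔ ℓ))
  IsMaxArcSize n m = HasProjectiveArc m n × (∀ k → HasProjectiveArc k n → k ≤ m)

{-# OPTIONS --safe #-}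

-- Let q ≥ 3 and n = q² − 2 − d with 0 ≤ d ≤ q − 2.  Every element of R is
-- τ i + ρ k, where τ is a transversal of rad R and ρ k = π τ k runs over rad R.
-- The arc is the complement of a set B meeting every line in at least q + d + 2
-- points.  B is a union of segments, a segment being the q points which a line
-- has in a class of neighbouring points:
--
--   * in an affine class with x ∈ τ i + rad R, two vertical segments if i < d,
--     and one segment of direction τ i otherwise;
--   * in the class at infinity of slope τ i, two segments along the line at
--     infinity if i < d, and three otherwise;
--   * in the class of the vertical point at infinity, d + 2 segments along the
--     line at infinity.
--
-- A line y = α x + β meets each segment of another direction exactly once.  Its
-- only loss is in the column i ≥ d with τ i ≡ α, and there the third segment at
-- infinity makes up for it.  The lines of the class of a given line form an
-- affine plane of order q whose lines are the segments in that direction.  The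
-- positions of the segments of B are chosen, mostly as pencils of that plane, so
-- that they cover every point once (vertical lines) or twice (neighbours of the
-- line at infinity).  For q = 2 a class of neighbouring points is the desired arc.

module Submission where

open import Defs
open import Level using (_⊔_; Lift; lift; lower)
open import Algebra.Bundles using (Ring; CommutativeRing)
open import Algebra.Module.Bundles using (RightModule)
open import Algebra.Morphism.Structures using (module RingMorphisms)
import Algebra.Properties.CommutativeSemigroup as CommutativeSemigroupProperties
import Algebra.Properties.Ring as RingProperties
open import Data.Bool using (Bool; if_then_else_; true; false; T)
open import Data.Empty using (⊥-elim)
open import Data.Fin using (Fin; zero; suc; toℕ)
import Data.Fin as Fin
open import Data.Fin.Patterns using (0F; 1F; 2F)
import Data.Fin.Permutation as Perm
open import Data.Fin.Properties using (any?)
open import Data.List using (List; []; _∷_; map; filter; _++_; length; allFin; cartesianProductWith; cartesianProduct)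
import Data.List.Properties as List
open import Data.List.Membership.Propositional using () renaming (_∈_ to _∈ˡ_)
open import Data.List.Membership.Propositional.Properties
  using (∈-++⁺ˡ; ∈-++⁺ʳ; ∈-++⁻; ∈-cartesianProductWith⁺; ∈-cartesianProductWith⁻; ∈-cartesianProduct⁺; ∈-allFin; ∈-filter⁺; ∈-filter⁻; ∈-map⁺)
import Data.List.Membership.Setoid.Properties as Membershipₛ
open import Data.List.Relation.Unary.All using (All; []; _∷_)
open import Data.List.Relation.Unary.AllPairs using ([]; _∷_)
open import Data.List.Relation.Unary.Any using (here; there)
open import Data.List.Relation.Unary.Unique.Propositional using (Unique)
import Data.List.Relation.Unary.Unique.Propositional.Properties as Unique
import Data.List.Relation.Unary.Unique.Setoid.Properties as Uniqueₛ
open import Data.Nat as ℕ using (ℕ; _≤_; _<ᵇ_; z≤n; s≤s)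
open import Data.Nat.ListAction using (sum)
import Data.Nat.Properties as ℕ
open import Data.Nat.Tactic.RingSolver using (solve-∀)
open import Data.Product using (_×_; ∃; ∃-syntax; _,_; proj₁; proj₂)
open import Data.Sum using (_⊎_; inj₁; inj₂)
open import Data.Unit using (⊤; tt)
open import Function.Base using (_∘_; id)
open import Function.Bundles using (Inverse; Equivalence; _⇔_; mk⇔)
open import Function.Construct.Composition using (_⇔-∘_)
open import Relation.Binary.Bundles using (Setoid)
open import Relation.Binary.Definitions using () renaming (Decidable to Decidable₂)
open import Relation.Binary.PropositionalEquality as ≡ using (_≡_; _≢_)
import Relation.Binary.Reasoning.Setoid as SetoidReasoning
open import Relation.Nullary using (¬_; Dec; yes; no; contradiction)
import Relation.Nullary.Decidable as Dec
open import Relation.Unary using (Pred; Decidable; U; _∈_)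

-- Finite sums of natural numbers

module FiniteSums where

  open import Data.Fin.Properties using (suc-injective)
  open import Data.List using (tabulate)
  open import Data.Nat using (suc; _+_; _*_)
  open import Data.Nat.ListAction.Properties using (sum-++)
  open import Data.Nat.Properties hiding (suc-injective)
  import Algebra.Properties.Semiring.Sum +-*-semiring as Sum
  open import Relation.Binary.PropositionalEquality using (refl; sym; trans; cong; cong₂; subst)
  open import Relation.Nullary using (does)

  -- Abstract, so that sums over Fin (suc p) do not unfold during unification.
  abstract
    ∑ : ∀ {n} → (Fin n → ℕ) → ℕ
    ∑ = Sum.sum

    ∑-cong : ∀ {n} {f g : Fin n → ℕ} → (∀ i → f i ≡ g i) → ∑ f ≡ ∑ g
    ∑-cong = Sum.sum-cong-≗

    ∑-distrib-+ : ∀ {n} (f g : Fin n → ℕ) → ∑ (λ i → f i + g i) ≡ ∑ f + ∑ g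
    ∑-distrib-+ = Sum.∑-distrib-+

    *-distribˡ-∑ : ∀ {n} c (f : Fin n → ℕ) → c * ∑ f ≡ ∑ (λ i → c * f i)
    *-distribˡ-∑ = Sum.*-distribˡ-sum

    ∑-comm : ∀ {m n} (f : Fin m → Fin n → ℕ) → ∑ (λ i → ∑ (λ j → f i j)) ≡ ∑ (λ j → ∑ (λ i → f i j))
    ∑-comm = Sum.∑-comm

    ∑-mono : ∀ {n} {f g : Fin n → ℕ} → (∀ i → f i ≤ g i) → ∑ f ≤ ∑ g
    ∑-mono {ℕ.zero} h = z≤n
    ∑-mono {suc n}  h = +-mono-≤ (h zero) (∑-mono (h ∘ suc))

    ∑-const : ∀ n c → ∑ {n} (λ _ → c) ≡ n * c
    ∑-const ℕ.zero  c = refl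
    ∑-const (suc n) c = cong (c +_) (∑-const n c)

    ∑-single : ∀ {n} {f : Fin n → ℕ} i → (∀ j → j ≢ i → f j ≡ 0) → ∑ f ≡ f i
    ∑-single {suc n} {f} zero h = trans (cong (f zero +_) (trans
      (∑-cong λ j → h (suc j) λ ()) (trans (∑-const n 0) (*-zeroʳ n)))) (+-identityʳ _)
    ∑-single (suc i) h = cong₂ _+_ (h zero λ ()) (∑-single i λ j j≢i → h (suc j) (j≢i ∘ suc-injective))

    ∑-threshold : ∀ d e a b → ∑ {d + e} (λ i → if toℕ i <ᵇ d then a else b) ≡ d * a + e * b
    ∑-threshold ℕ.zero  e a b = ∑-const e b
    ∑-threshold (suc d) e a b = trans (cong (a +_) (∑-threshold d e a b)) (sym (+-assoc a (d * a) (e * b)))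

    sum-map-tabulate : ∀ {a} {A : Set a} {n} (f : A → ℕ) (g : Fin n → A) → sum (map f (tabulate g)) ≡ ∑ (f ∘ g)
    sum-map-tabulate {n = ℕ.zero} f g = refl
    sum-map-tabulate {n = suc n}  f g = cong (f (g zero) +_) (sum-map-tabulate f (g ∘ suc))

  ∑-zero : ∀ {n} {f : Fin n → ℕ} → (∀ i → f i ≡ 0) → ∑ f ≡ 0
  ∑-zero {n} h = trans (∑-cong h) (trans (∑-const n 0) (*-zeroʳ n))

  ∑-comm₃ : ∀ {n} (f : Fin n → Fin n → Fin n → ℕ) →
            ∑ (λ i → ∑ λ j → ∑ λ k → f i j k) ≡ ∑ (λ k → ∑ λ i → ∑ λ j → f i j k)
  ∑-comm₃ f = trans (∑-cong λ i → ∑-comm (f i)) (∑-comm λ i k → ∑ λ j → f i j k)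

  ∑-comm₄ : ∀ {n} (f : Fin n → Fin n → Fin n → Fin n → ℕ) →
            ∑ (λ i → ∑ λ j → ∑ λ k → ∑ λ l → f i j k l) ≡ ∑ (λ k → ∑ λ l → ∑ λ i → ∑ λ j → f i j k l)
  ∑-comm₄ f = trans (∑-comm₃ λ i j k → ∑ (f i j k)) (∑-cong λ k → ∑-comm₃ λ i j l → f i j k l)

  restrict : ∀ {p} {P : Set p} → Dec P → ℕ → ℕ
  restrict P? n = if does P? then n else 0

  restrict-yes : ∀ {p} {P : Set p} (P? : Dec P) {n} → P → restrict P? n ≡ n
  restrict-yes (yes _) _ = refl
  restrict-yes (no ¬p) p = contradiction p ¬p

  restrict-no : ∀ {p} {P : Set p} (P? : Dec P) {n} → ¬ P → restrict P? n ≡ 0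
  restrict-no (yes p) ¬p = contradiction p ¬p
  restrict-no (no _)  _  = refl

  -- Serves to eliminate a coordinate which the equation of a line determines from the others.
  ∑-restrict : ∀ {n p} {P : Fin n → Set p} (P? : ∀ i → Dec (P i)) (f : Fin n → ℕ) {i₀} →
               (∀ {i} → P i → i ≡ i₀) → P i₀ → ∑ (λ i → restrict (P? i) (f i)) ≡ f i₀
  ∑-restrict P? f {i₀} unique p = trans (∑-single i₀ λ j j≢ → restrict-no (P? j) (j≢ ∘ unique))
    (restrict-yes (P? i₀) p)

  ∑∑-restrict : ∀ {n p} {P : Fin n → Fin n → Set p} (P? : ∀ i j → Dec (P i j)) (f : Fin n → Fin n → ℕ) {i₀ j₀} →
                (∀ {i j} → P i j → i ≡ i₀ × j ≡ j₀) → P i₀ j₀ →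
                ∑ (λ i → ∑ λ j → restrict (P? i j) (f i j)) ≡ f i₀ j₀
  ∑∑-restrict P? f {i₀} unique p = trans
    (∑-single i₀ λ i i≢ → ∑-zero λ j → restrict-no (P? i j) (i≢ ∘ proj₁ ∘ unique))
    (∑-restrict (P? i₀) (f i₀) (proj₂ ∘ unique) p)

  outside : ∀ {n} → List (Fin n) → Fin n → ℕ
  outside []       k = 1
  outside (x ∷ xs) k = if does (k Fin.≟ x) then 0 else outside xs k

  outside≤1 : ∀ {n} xs (k : Fin n) → outside xs k ≤ 1
  outside≤1 []       k = ≤-refl
  outside≤1 (x ∷ xs) k with k Fin.≟ x
  ... | yes _ = z≤n
  ... | no _  = outside≤1 xs k

  outside-01 : ∀ {n} xs (k : Fin n) → outside xs k ≡ 0 ⊎ outside xs k ≡ 1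
  outside-01 []       k = inj₂ refl
  outside-01 (x ∷ xs) k with k Fin.≟ x
  ... | yes _ = inj₁ refl
  ... | no _  = outside-01 xs k

  outside-∈ : ∀ {n} {xs} {k : Fin n} → k ∈ˡ xs → outside xs k ≡ 0
  outside-∈ {xs = x ∷ xs} {k} k∈ with k Fin.≟ x | k∈
  ... | yes _   | _         = refl
  ... | no k≢x  | here k≡x  = contradiction k≡x k≢x
  ... | no _    | there k∈′ = outside-∈ k∈′

  outside-singleton : ∀ {n} {w z k k₀ : Fin n} → w ≡ z ⇔ k ≡ k₀ → outside (z ∷ []) w ≡ outside (k₀ ∷ []) k
  outside-singleton {w = w} {z} {k} {k₀} eq with w Fin.≟ z | k Fin.≟ k₀
  ... | yes _   | yes _    = refl
  ... | no _    | no _     = refl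
  ... | yes w≡z | no k≢k₀  = contradiction (Equivalence.to eq w≡z) k≢k₀
  ... | no w≢z  | yes k≡k₀ = contradiction (Equivalence.from eq k≡k₀) w≢z

  outside-∉ : ∀ {n} {xs} {k : Fin n} → All (k ≢_) xs → outside xs k ≡ 1
  outside-∉ [] = refl
  outside-∉ {k = k} (_∷_ {x} k≢x k∉) with k Fin.≟ x
  ... | yes k≡x = contradiction k≡x k≢x
  ... | no _    = outside-∉ k∉

  ∑-outside : ∀ {n} {xs : List (Fin n)} → Unique xs → ∑ (outside xs) + length xs ≡ n
  ∑-outside {n} [] = trans (+-identityʳ _) (trans (∑-const n 1) (*-identityʳ n))
  ∑-outside {n} {x ∷ xs} (x∉xs ∷ xs!) = trans (+-suc _ _) (trans (cong (_+ length xs) step) (∑-outside xs!))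
    where
    one : ∑ (λ k → restrict (k Fin.≟ x) 1) ≡ 1
    one = ∑-restrict (Fin._≟ x) (λ _ → 1) id refl

    pointwise : ∀ k → restrict (k Fin.≟ x) 1 + outside (x ∷ xs) k ≡ outside xs k
    pointwise k with k Fin.≟ x
    ... | yes refl = sym (outside-∉ x∉xs)
    ... | no _     = refl

    step : suc (∑ (outside (x ∷ xs))) ≡ ∑ (outside xs)
    step = trans (cong (_+ ∑ (outside (x ∷ xs))) (sym one))
      (trans (sym (∑-distrib-+ (λ k → restrict (k Fin.≟ x) 1) (outside (x ∷ xs)))) (∑-cong pointwise))

  -- Pointwise `f` is at most `c` times the indicator function of the complement of `zs`, so every
  -- zero of `f` saves `c`.
  ∑-vanishing : ∀ {n} c {f : Fin n → ℕ} → (∀ k → f k ≤ c) → ∀ {zs} → Unique zs → All (λ z → f z ≡ 0) zs →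
                ∑ f + c * length zs ≤ c * n
  ∑-vanishing {n} c {f} f≤c {zs} zs! f0 = begin
    ∑ f + c * length zs                ≤⟨ +-monoˡ-≤ _ (∑-mono (pointwise f0)) ⟩
    ∑ (λ k → c * outside zs k) + c * length zs ≡⟨ cong (_+ c * length zs) (sym (*-distribˡ-∑ c (outside zs))) ⟩
    c * ∑ (outside zs) + c * length zs ≡⟨ sym (*-distribˡ-+ c _ _) ⟩
    c * (∑ (outside zs) + length zs)   ≡⟨ cong (c *_) (∑-outside zs!) ⟩
    c * n                              ∎
    where
    open ≤-Reasoning

    pointwise : ∀ {zs} → All (λ z → f z ≡ 0) zs → ∀ k → f k ≤ c * outside zs k
    pointwise []       k = subst (f k ≤_) (sym (*-identityʳ c)) (f≤c k)
    pointwise (_∷_ {z} f0 f0s) k with k Fin.≟ z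
    ... | yes refl = subst (_≤ c * 0) (sym f0) z≤n
    ... | no _     = pointwise f0s k

  module _ {a} {A : Set a} where

    sum-map-filter : ∀ {p} {P : Pred A p} (P? : Decidable P) (f : A → ℕ) xs →
                     sum (map f (filter P? xs)) ≡ sum (map (λ x → restrict (P? x) (f x)) xs)
    sum-map-filter P? f [] = refl
    sum-map-filter P? f (x ∷ xs) with does (P? x)
    ... | true  = cong (f x +_) (sum-map-filter P? f xs)
    ... | false = sum-map-filter P? f xs

    sum-map-++ : ∀ (f : A → ℕ) xs ys → sum (map f (xs ++ ys)) ≡ sum (map f xs) + sum (map f ys)
    sum-map-++ f xs ys = trans (cong sum (List.map-++ f xs ys)) (sum-++ (map f xs) (map f ys))

  sum-map-product : ∀ {a b c} {A : Set a} {B : Set b} {C : Set c} (f : C → ℕ) (g : A → B → C) xs ys →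
                    sum (map f (cartesianProductWith g xs ys)) ≡ sum (map (λ x → sum (map (f ∘ g x) ys)) xs)
  sum-map-product f g []       ys = refl
  sum-map-product f g (x ∷ xs) ys = trans (sum-map-++ f (map (g x) ys) _)
    (cong₂ _+_ (cong sum (sym (List.map-∘ ys))) (sum-map-product f g xs ys))

open FiniteSums

-- Coordinates on a chain ring of length 2 with q = p + 1

record Coordinates {c ℓ} (R : Ring c ℓ) (p : ℕ) : Set (c ⊔ ℓ) where
  open Ring R hiding (zero)
  field
    res     : Carrier → Fin (ℕ.suc p)
    τ       : Fin (ℕ.suc p) → Carrier
    τ-zero  : τ zero ≈ 0#
    res-τ   : ∀ i → res (τ i) ≡ i

  -- Stands for the radical. Unlike `rad`, which quantifies over ideals, it is decidable and lies in
  -- the lowest universe.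
  Nil : Carrier → Set
  Nil x = res x ≡ zero

  field
    res⇒nil : ∀ {x y} → res x ≡ res y → Nil (x - y)
    nil⇒res : ∀ {x y} → Nil (x - y) → res x ≡ res y
    res-cong : ∀ {x y} → x ≈ y → res x ≡ res y
    nil-+   : ∀ {x y} → Nil x → Nil y → Nil (x + y)
    nil-*ˡ  : ∀ r {x} → Nil x → Nil (r * x)
    nil-*ʳ  : ∀ r {x} → Nil x → Nil (x * r)
    nil-*   : ∀ {x y} → Nil x → Nil y → x * y ≈ 0#
    1-unit  : ¬ Nil 1#
    inverse : ∀ {x} → ¬ Nil x → ∃ λ y → x * y ≈ 1# × y * x ≈ 1#
    divide  : ∀ {x y} → Nil x → ¬ x ≈ 0# → Nil y → ∃ λ s → y ≈ x * s
    π       : Carrier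
    π-nil   : Nil π
    π≉0     : ¬ π ≈ 0#

-- Coordinates from the chain conditions

module _ {c ℓ a ℓ₁} (R : Ring c ℓ) (chain : IsFiniteChainRingOfLength2 R)
         (𝔽 : CommutativeRing a ℓ₁) {p}
         (size : HasSize (CommutativeRing.setoid 𝔽) (ℕ.suc p))
         (iso : ∃ (RingMorphisms.IsRingIsomorphism (R/rad R) (CommutativeRing.rawRing 𝔽)))
         where

  private
    open Ring R hiding (zero)
    open RingProperties R
    open IsFiniteChainRingOfLength2 chain
    module 𝔽 = CommutativeRing 𝔽
    open RingMorphisms.IsRingIsomorphism (proj₂ iso) using (surjective; injective; ⟦⟧-cong; 0#-homo; +-homo; *-homo)
    module F = Inverse size
    module N = Inverse (proj₂ finite)

    φ : Carrier → 𝔽.Carrier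
    φ = proj₁ iso

    maximal = proj₁ (proj₂ local)
    I = proj₁ local

    -- This and `I⊆rad` replace the intersection `rad` by the single maximal right ideal that
    -- locality provides.
    rad⊆I : ∀ {x} → rad R x → x ∈ ⟦ I ⟧
    rad⊆I r = r I maximal

    I⊆rad : ∀ {x} → x ∈ ⟦ I ⟧ → rad R x
    I⊆rad x∈I J J-max = proj₂ (proj₂ (proj₂ local) J J-max) x∈I

    module I = Submodule I

    rad-resp : ∀ {x y} → x ≈ y → rad R x → rad R y
    rad-resp x≈y r = I⊆rad (I.respects x≈y (rad⊆I r))

    x-0≈x : ∀ x → x - 0# ≈ x
    x-0≈x x = trans (+-congˡ -0#≈0#) (+-identityʳ x)

    -- The transposition moves the index of `𝔽.0#` to `zero`, so that residue `zero` will mean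
    -- membership in the radical.
    label : 𝔽.Carrier → Fin (ℕ.suc p)
    label x = Perm.transpose (F.to 𝔽.0#) zero Perm.⟨$⟩ʳ F.to x

    unlabel : Fin (ℕ.suc p) → 𝔽.Carrier
    unlabel i = F.from (Perm.transpose (F.to 𝔽.0#) zero Perm.⟨$⟩ˡ i)

    label-unlabel : ∀ i → label (unlabel i) ≡ i
    label-unlabel i = ≡.trans
      (≡.cong (Perm.transpose (F.to 𝔽.0#) zero Perm.⟨$⟩ʳ_) (F.strictlyInverseˡ _))
      (Perm.inverseʳ (Perm.transpose (F.to 𝔽.0#) zero))

    label-cong : ∀ {x y} → x 𝔽.≈ y → label x ≡ label y
    label-cong eq = ≡.cong (Perm.transpose (F.to 𝔽.0#) zero Perm.⟨$⟩ʳ_) (F.to-cong eq)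

    label-injective : ∀ {x y} → label x ≡ label y → x 𝔽.≈ y
    label-injective {x} {y} eq = 𝔽.trans (𝔽.sym (F.strictlyInverseʳ x)) (𝔽.trans
      (F.from-cong (≡.trans (≡.sym (Perm.inverseˡ π₀)) (≡.trans (≡.cong (π₀ Perm.⟨$⟩ˡ_) eq) (Perm.inverseˡ π₀))))
      (F.strictlyInverseʳ y))
      where π₀ = Perm.transpose (F.to 𝔽.0#) zero

    label-0 : label 𝔽.0# ≡ zero
    label-0 with F.to 𝔽.0# Fin.≟ F.to 𝔽.0#
    ... | yes _ = ≡.refl
    ... | no ≢ = contradiction ≡.refl ≢

    residue : Carrier → Fin (ℕ.suc p)
    residue x = label (φ x)

    section : Fin (ℕ.suc p) → Carrier
    -- Chosen as 0 itself, not just any preimage, for the sake of `τ-zero`.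
    section zero    = 0#
    section (suc i) = proj₁ (surjective (unlabel (suc i)))

    rad-0 : ∀ {x} → x ≈ 0# → rad R x
    rad-0 x≈0 = I⊆rad (I.respects (sym x≈0) I.0-closed)

    φ-cong : ∀ {x y} → x ≈ y → φ x 𝔽.≈ φ y
    φ-cong x≈y = ⟦⟧-cong (rad-0 (trans (+-congʳ x≈y) (-‿inverseʳ _)))

    rad⇒φ0 : ∀ {x} → rad R x → φ x 𝔽.≈ 𝔽.0#
    rad⇒φ0 {x} r = 𝔽.trans (⟦⟧-cong (rad-resp (sym (x-0≈x x)) r)) 0#-homo

    φ0⇒rad : ∀ {x} → φ x 𝔽.≈ 𝔽.0# → rad R x
    φ0⇒rad {x} eq = rad-resp (x-0≈x x) (injective (𝔽.trans eq (𝔽.sym 0#-homo)))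

    nil⇒φ0 : ∀ {x} → residue x ≡ zero → φ x 𝔽.≈ 𝔽.0#
    nil⇒φ0 eq = label-injective (≡.trans eq (≡.sym label-0))

    φ0⇒nil : ∀ {x} → φ x 𝔽.≈ 𝔽.0# → residue x ≡ zero
    φ0⇒nil eq = ≡.trans (label-cong eq) label-0

    nil⇒rad : ∀ {x} → residue x ≡ zero → rad R x
    nil⇒rad eq = φ0⇒rad (nil⇒φ0 eq)

    rad⇒nil : ∀ {x} → rad R x → residue x ≡ zero
    rad⇒nil r = φ0⇒nil (rad⇒φ0 r)

    _≈?_ : Decidable₂ _≈_
    x ≈? y = Dec.map′ (λ eq → trans (sym (N.strictlyInverseʳ x)) (trans (N.from-cong eq) (N.strictlyInverseʳ y)))
                      N.to-cong (N.to x Fin.≟ N.to y)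

    -- The right ideal xR. The factor is an index into the finite enumeration of `R`, which makes
    -- membership decidable and the chain condition applicable.
    multiples : Carrier → RightIdeal R
    multiples x = record
      { ⟦_⟧ = λ y → Lift c (∃ λ i → y ≈ x * N.from i)
      ; respects = λ { eq (lift (i , h)) → lift (i , trans (sym eq) h) }
      ; 0-closed = make 0# (sym (zeroʳ x))
      ; +-closed = λ { (lift (i , h)) (lift (j , h′)) →
          make (N.from i + N.from j) (trans (+-cong h h′) (sym (distribˡ x _ _))) }
      ; *ᵣ-closed = λ { s (lift (i , h)) →
          make (N.from i * s) (trans (*-congʳ h) (*-assoc x _ s)) }
      }
      where
      make : ∀ {y} s → y ≈ x * s → Lift c (∃ λ i → y ≈ x * N.from i)
      make s h = lift (N.to s , trans h (*-congˡ (sym (N.strictlyInverseʳ s))))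

    multiples? : ∀ x → Decidable ⟦ multiples x ⟧
    multiples? x y = Dec.map′ lift lower (any? λ i → y ≈? (x * N.from i))

    x∈multiples : ∀ x → x ∈ ⟦ multiples x ⟧
    x∈multiples x = lift (N.to 1# , trans (sym (*-identityʳ x)) (*-congˡ (sym (N.strictlyInverseʳ 1#))))

    1∉rad : ¬ rad R 1#
    1∉rad r = proj₂ rad⊂R (λ {x} _ → I⊆rad (I.respects (*-identityˡ x) (I.*ᵣ-closed x (rad⊆I r))))

    -- Of the three right ideals in the chain, only `R` itself can contain `x`, so xR contains 1.
    rightInverse : ∀ {x} → ¬ rad R x → ∃ λ y → x * y ≈ 1#
    rightInverse {x} x∉ with rightChain (multiples x) (multiples? x)
    ... | inj₁ all with proj₂ all {1#} _
    ...   | lift (i , h) = N.from i , sym h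
    rightInverse {x} x∉ | inj₂ (inj₁ r) = contradiction (proj₁ r (x∈multiples x)) x∉
    rightInverse {x} x∉ | inj₂ (inj₂ z) = contradiction (rad-0 (proj₁ z (x∈multiples x))) x∉

    rad-*ʳ : ∀ r {x} → rad R x → rad R (x * r)
    rad-*ʳ r h = I⊆rad (I.*ᵣ-closed r (rad⊆I h))

    -- As `rad` is built from right ideals, closure on this side comes from its being the kernel of
    -- `φ`.
    rad-*ˡ : ∀ r {x} → rad R x → rad R (r * x)
    rad-*ˡ r h = φ0⇒rad (𝔽.trans (*-homo _ _) (𝔽.trans (𝔽.*-congˡ (rad⇒φ0 h)) (𝔽.zeroʳ _)))

    -- The right inverse `y` is not in the radical either, since xy ≈ 1 is not; hence it has a right
    -- inverse `z`, and associativity gives x ≈ z.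
    twoSidedInverse : ∀ {x} → ¬ rad R x → ∃ λ y → x * y ≈ 1# × y * x ≈ 1#
    twoSidedInverse {x} x∉ with rightInverse x∉
    ... | y , xy≈1 with rightInverse {y} (λ r → 1∉rad (rad-resp xy≈1 (rad-*ˡ x r)))
    ...   | z , yz≈1 = y , xy≈1 , trans (*-congˡ x≈z) yz≈1
      where
      x≈z : x ≈ z
      x≈z = trans (sym (*-identityʳ x)) (trans (*-congˡ (sym yz≈1)) (trans (sym (*-assoc x y z))
              (trans (*-congʳ xy≈1) (*-identityˡ z))))

    -- The ideal xR is neither 0, as x ≉ 0, nor `R`, as it lies in the radical; by the chain
    -- condition it is the whole radical.
    divide-rad : ∀ {x y} → rad R x → ¬ x ≈ 0# → rad R y → ∃ λ s → y ≈ x * s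
    divide-rad {x} {y} x∈ x≉0 y∈ with rightChain (multiples x) (multiples? x)
    ... | inj₁ all with proj₂ all {1#} _
    ...   | lift (i , h) = contradiction (rad-resp (sym h) (rad-*ʳ _ x∈)) 1∉rad
    divide-rad {x} {y} x∈ x≉0 y∈ | inj₂ (inj₁ r) with proj₂ r y∈
    ... | lift (i , h) = N.from i , h
    divide-rad {x} {y} x∈ x≉0 y∈ | inj₂ (inj₂ z) = contradiction (proj₁ z (x∈multiples x)) x≉0

    generator : ∃ λ x → rad R x × ¬ x ≈ 0#
    generator with any? (λ i → (residue (N.from i) Fin.≟ zero) Dec.×-dec Dec.¬? (N.from i ≈? 0#))
    ... | yes (i , nil , ≉0) = N.from i , nil⇒rad nil , ≉0
    ... | no none = ⊥-elim (proj₂ 0⊂rad rad⊆0)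
      where
      rad⊆0 : ∀ {x} → rad R x → x ≈ 0#
      rad⊆0 {x} x∈ with x ≈? 0#
      ... | yes x≈0 = x≈0
      ... | no x≉0 = contradiction
        (N.to x , rad⇒nil (rad-resp (sym (N.strictlyInverseʳ x)) x∈)
                , λ h → x≉0 (trans (sym (N.strictlyInverseʳ x)) h)) none

    res-section : ∀ i → residue (section i) ≡ i
    res-section zero    = φ0⇒nil 0#-homo
    res-section (suc i) = ≡.trans
      (label-cong (proj₂ (surjective (unlabel (suc i))) (rad-0 (-‿inverseʳ _))))
      (label-unlabel (suc i))

  coordinates : Coordinates R p
  coordinates = record
    { res      = residue
    ; τ        = section
    ; τ-zero   = refl
    ; res-τ    = res-section
    ; res⇒nil  = λ eq → rad⇒nil (injective (label-injective eq))
    ; nil⇒res  = λ nil → label-cong (⟦⟧-cong (nil⇒rad nil))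
    ; res-cong = λ eq → label-cong (φ-cong eq)
    ; nil-+    = λ h h′ → rad⇒nil (I⊆rad (I.+-closed (rad⊆I (nil⇒rad h)) (rad⊆I (nil⇒rad h′))))
    ; nil-*ˡ   = λ r h → rad⇒nil (rad-*ˡ r (nil⇒rad h))
    ; nil-*ʳ   = λ r h → rad⇒nil (rad-*ʳ r (nil⇒rad h))
    ; nil-*    = λ h h′ → rad²≈0 (nil⇒rad h) (nil⇒rad h′)
    ; 1-unit   = λ h → 1∉rad (nil⇒rad h)
    ; inverse  = λ h → twoSidedInverse (λ r → h (rad⇒nil r))
    ; divide   = λ h ≉0 h′ → divide-rad (nil⇒rad h) ≉0 (nil⇒rad h′)
    ; π        = proj₁ generator
    ; π-nil    = rad⇒nil (proj₁ (proj₂ generator))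
    ; π≉0      = proj₂ (proj₂ generator)
    }

-- Arithmetic with residues and radical digits

module CoordinateProperties {c ℓ} (R : Ring c ℓ) {p} (C : Coordinates R p) where
  open Ring R hiding (zero)
  open RingProperties R
  open Coordinates C

  nil? : ∀ x → Dec (Nil x)
  nil? x = res x Fin.≟ zero

  nil-resp : ∀ {x y} → x ≈ y → Nil x → Nil y
  nil-resp x≈y = ≡.trans (≡.sym (res-cong x≈y))

  x≈y+[x-y] : ∀ x y → x ≈ y + (x - y)
  x≈y+[x-y] x y = trans (sym (trans (+-congˡ (-‿inverseˡ y)) (+-identityʳ x)))
    (trans (sym (+-assoc x (- y) y)) (+-comm (x - y) y))

  x-y≈z⇒x≈y+z : ∀ {x y z} → x - y ≈ z → x ≈ y + z
  x-y≈z⇒x≈y+z {x} {y} eq = trans (x≈y+[x-y] x y) (+-congˡ eq)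

  [x+y]-x≈y : ∀ x y → (x + y) - x ≈ y
  [x+y]-x≈y x y = trans (+-congʳ (+-comm x y)) (trans (+-assoc y x (- x))
    (trans (+-congˡ (-‿inverseʳ x)) (+-identityʳ y)))

  nil-neg : ∀ {x} → Nil x → Nil (- x)
  nil-neg {x} h = nil-resp (-1*x≈-x x) (nil-*ˡ (- 1#) h)

  annihilator-nil : ∀ {x s} → ¬ x ≈ 0# → x * s ≈ 0# → Nil s
  annihilator-nil {x} {s} x≉0 xs≈0 with nil? s
  ... | yes h = h
  ... | no h with inverse h
  ...   | t , st≈1 , _ = contradiction
    (trans (sym (*-identityʳ x)) (trans (*-congˡ (sym st≈1)) (trans (sym (*-assoc x s t))
      (trans (*-congʳ xs≈0) (zeroˡ t))))) x≉0

  -- Two factors of equal residue differ by a nil element, and products of nil elements vanish: the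
  -- residue field acts on the radical from the right.
  *-nil-cong : ∀ {x s t} → Nil x → res s ≡ res t → x * s ≈ x * t
  *-nil-cong {x} {s} {t} h eq = x∙y⁻¹≈ε⇒x≈y _ _
    (trans (sym (x[y-z]≈xy-xz x s t)) (nil-* h (res⇒nil eq)))

  *-nil-cancel : ∀ {x s t} → ¬ x ≈ 0# → x * s ≈ x * t → res s ≡ res t
  *-nil-cancel {x} {s} {t} x≉0 eq = nil⇒res (annihilator-nil x≉0
    (trans (x[y-z]≈xy-xz x s t) (x≈y⇒x∙y⁻¹≈ε eq)))

  ρ : Fin (ℕ.suc p) → Carrier
  ρ k = π * τ k

  ρ-nil : ∀ k → Nil (ρ k)
  ρ-nil k = nil-*ʳ (τ k) π-nil

  ρ-zero : ρ zero ≈ 0#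
  ρ-zero = trans (*-congˡ τ-zero) (zeroʳ π)

  ρ-injective : ∀ {k k′} → ρ k ≈ ρ k′ → k ≡ k′
  ρ-injective {k} {k′} eq = ≡.trans (≡.sym (res-τ k)) (≡.trans (*-nil-cancel π≉0 eq) (res-τ k′))

  ⟨_,_⟩ : Fin (ℕ.suc p) → Fin (ℕ.suc p) → Carrier
  ⟨ i , k ⟩ = τ i + ρ k

  abstract
    -- The radical digit of `x`: x - τ (res x) is nil, hence π s for some `s`, and only the residue
    -- of `s` matters. All further properties follow from `expand`.
    ι : Carrier → Fin (ℕ.suc p)
    ι x = res (proj₁ (divide π-nil π≉0 (res⇒nil {x} (≡.sym (res-τ (res x))))))

    expand : ∀ x → x ≈ ⟨ res x , ι x ⟩
    expand x = x-y≈z⇒x≈y+z (trans (proj₂ (divide π-nil π≉0 (res⇒nil {x} (≡.sym (res-τ (res x))))))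
      (*-nil-cong π-nil (≡.sym (res-τ _))))

  res-⟨⟩ : ∀ i k → res ⟨ i , k ⟩ ≡ i
  res-⟨⟩ i k = ≡.trans (nil⇒res (nil-resp (sym ([x+y]-x≈y (τ i) (ρ k))) (ρ-nil k))) (res-τ i)

  ⟨⟩-injective : ∀ {i k i′ k′} → ⟨ i , k ⟩ ≈ ⟨ i′ , k′ ⟩ → i ≡ i′ × k ≡ k′
  ⟨⟩-injective {i} {k} {i′} {k′} eq with ≡.trans (≡.sym (res-⟨⟩ i k)) (≡.trans (res-cong eq) (res-⟨⟩ i′ k′))
  ... | ≡.refl = ≡.refl , ρ-injective (+-cancelˡ _ _ _ eq)

  ι-⟨⟩ : ∀ i k → ι ⟨ i , k ⟩ ≡ k
  ι-⟨⟩ i k = ≡.sym (proj₂ (⟨⟩-injective (expand ⟨ i , k ⟩)))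

  ι-cong : ∀ {x y} → x ≈ y → ι x ≡ ι y
  ι-cong {x} {y} eq = proj₂ (⟨⟩-injective (trans (sym (expand x)) (trans eq (expand y))))

  nil-expand : ∀ {x} → Nil x → x ≈ ρ (ι x)
  nil-expand {x} h = trans (expand x)
    (trans (+-congʳ (trans (reflexive (≡.cong τ h)) τ-zero)) (+-identityˡ _))

  ι-ρ : ∀ k → ι (ρ k) ≡ k
  ι-ρ k = ρ-injective (sym (nil-expand (ρ-nil k)))

-- Normal forms of points

module Points {c ℓ} (R : Ring c ℓ) {p} (C : Coordinates R p) where
  open Ring R hiding (zero)
  open RingProperties R
  open Coordinates C
  open CoordinateProperties R C
  open PHG R
  open RightModule R³ using (Carrierᴹ; _≈ᴹ_; _+ᴹ_; _*ᵣ_; 0ᴹ; *ᵣ-assoc; *ᵣ-congˡ; *ᵣ-congʳ; *ᵣ-identityʳ; *ᵣ-zeroʳ; *ᵣ-distribˡ; +ᴹ-identityʳ; +ᴹ-cong; ≈ᴹ-sym; ≈ᴹ-trans)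

  -- Normal forms of a generator, according to which coordinate is the first unit in the order z, x,
  -- y; that coordinate becomes 1. The three kinds account for q⁴, q³ and q² points.
  data Place : Set where
    aff : (i k l m : Fin (ℕ.suc p)) → Place
    inf : (i k m : Fin (ℕ.suc p)) → Place
    ver : (a b : Fin (ℕ.suc p)) → Place

  vec : Place → Carrierᴹ
  vec (aff i k l m) = ⟨ i , k ⟩ , ⟨ l , m ⟩ , 1#
  vec (inf i k m)   = 1# , ⟨ i , k ⟩ , ρ m
  vec (ver a b)     = ρ a , 1# , ρ b

  span : Carrierᴹ → Submodule R³
  span v = record
    { ⟦_⟧       = λ w → ∃[ s ] w ≈ᴹ v *ᵣ s
    ; respects  = λ { eq (s , h) → s , ≈ᴹ-trans (≈ᴹ-sym eq) h }
    ; 0-closed  = 0# , ≈ᴹ-sym (*ᵣ-zeroʳ v)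
    ; +-closed  = λ { (s , h) (t , h′) → s + t , ≈ᴹ-trans (+ᴹ-cong h h′) (≈ᴹ-sym (*ᵣ-distribˡ v s t)) }
    ; *ᵣ-closed = λ { t (s , h) → s * t , ≈ᴹ-trans (*ᵣ-congʳ h) (*ᵣ-assoc v s t) }
    }

  vec-primitive : ∀ a s → vec a *ᵣ s ≈ᴹ 0ᴹ → s ≈ 0#
  vec-primitive (aff i k l m) s (_ , _ , h) = trans (sym (*-identityˡ s)) h
  vec-primitive (inf i k m)   s (h , _ , _) = trans (sym (*-identityˡ s)) h
  vec-primitive (ver a b)     s (_ , h , _) = trans (sym (*-identityˡ s)) h

  toPoint : Place → Point
  toPoint a = record
    { submodule = span (vec a)
    ; free      = (λ _ → vec a) , record
      { members     = λ _ → 1# , ≈ᴹ-sym (*ᵣ-identityʳ (vec a))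
      ; generates   = λ { (s , h) → (λ _ → s) , ≈ᴹ-trans h (≈ᴹ-sym (+ᴹ-identityʳ _)) }
      ; independent = λ { s h zero → vec-primitive a (s zero) (≈ᴹ-trans (≈ᴹ-sym (+ᴹ-identityʳ _)) h) }
      }
    }

  private
    unit≉nil*s : ∀ {x s} → Nil x → ¬ 1# ≈ x * s
    unit≉nil*s {s = s} h eq = 1-unit (nil-resp (sym eq) (nil-*ʳ s h))

    unit≉x*nil : ∀ {x s t} → Nil t → t ≈ 1# * s → ¬ 1# ≈ x * s
    unit≉x*nil {x} {s} h t≈s eq =
      1-unit (nil-resp (sym eq) (nil-*ˡ x (nil-resp (trans t≈s (*-identityˡ s)) h)))

    scalar-1 : ∀ {s x y} → 1# ≈ 1# * s → x ≈ y * s → x ≈ y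
    scalar-1 {s} {y = y} 1≈s h = trans h (trans (*-congˡ (sym (trans 1≈s (*-identityˡ s)))) (*-identityʳ y))

  -- For places of the same kind the coordinate 1 forces s ≈ 1; for different kinds some coordinate
  -- would be both 1 and nil. So one inclusion between points already makes their places equal.
  vec-injective : ∀ a b {s} → vec a ≈ᴹ vec b *ᵣ s → a ≡ b
  vec-injective (aff i k l m) (aff i′ k′ l′ m′) (h , h′ , e)
    with ⟨⟩-injective (scalar-1 e h) | ⟨⟩-injective (scalar-1 e h′)
  ... | ≡.refl , ≡.refl | ≡.refl , ≡.refl = ≡.refl
  vec-injective (aff i k l m) (inf i′ k′ m′) (_ , _ , h) = contradiction h (unit≉nil*s (ρ-nil m′))
  vec-injective (aff i k l m) (ver a′ b′)    (_ , _ , h) = contradiction h (unit≉nil*s (ρ-nil b′))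
  vec-injective (inf i k m) (aff i′ k′ l′ m′) (h , _ , e) = contradiction h (unit≉x*nil (ρ-nil m) e)
  vec-injective (inf i k m) (inf i′ k′ m′) (e , h , h′)
    with ⟨⟩-injective (scalar-1 e h) | ρ-injective (scalar-1 e h′)
  ... | ≡.refl , ≡.refl | ≡.refl = ≡.refl
  vec-injective (inf i k m) (ver a′ b′) (h , _ , _) = contradiction h (unit≉nil*s (ρ-nil a′))
  vec-injective (ver a b) (aff i′ k′ l′ m′) (_ , h , e) = contradiction h (unit≉x*nil (ρ-nil b) e)
  vec-injective (ver a b) (inf i′ k′ m′) (e , h , _) = contradiction h (unit≉x*nil (ρ-nil a) e)
  vec-injective (ver a b) (ver a′ b′) (h , e , h′)
    with ρ-injective (scalar-1 e h) | ρ-injective (scalar-1 e h′)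
  ... | ≡.refl | ≡.refl = ≡.refl

  private
    Represents : Carrierᴹ → Place → Set (c ⊔ ℓ)
    Represents v a = ∃[ t ] ∃[ u ] vec a ≈ᴹ v *ᵣ t × t * u ≈ 1#

    representative : ∀ v → (∀ s → v *ᵣ s ≈ᴹ 0ᴹ → s ≈ 0#) → ∃ (Represents v)
    representative v@(x , y , z) prim with nil? z | nil? x | nil? y
    ... | no h | _ | _ with inverse h
    ...   | t , zt≈1 , tz≈1 = aff (res (x * t)) (ι (x * t)) (res (y * t)) (ι (y * t)) , t , z ,
            (sym (expand _) , sym (expand _) , sym zt≈1) , tz≈1
    representative v@(x , y , z) prim | yes hz | no h | _ with inverse h
    ...   | t , xt≈1 , tx≈1 = inf (res (y * t)) (ι (y * t)) (ι (z * t)) , t , x ,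
            (sym xt≈1 , sym (expand _) , sym (nil-expand (nil-*ʳ t hz))) , tx≈1
    representative v@(x , y , z) prim | yes hz | yes hx | no h with inverse h
    ...   | t , yt≈1 , ty≈1 = ver (ι (x * t)) (ι (z * t)) , t , y ,
            (sym (nil-expand (nil-*ʳ t hx)) , sym yt≈1 , sym (nil-expand (nil-*ʳ t hz))) , ty≈1
    -- A vector without a unit coordinate is killed by `π` and generates no free module.
    representative v@(x , y , z) prim | yes hz | yes hx | yes hy =
      contradiction (prim π (nil-* hx π-nil , nil-* hy π-nil , nil-* hz π-nil)) π≉0

    module _ (x : Point) where
      open Point x
      open IsBasis (proj₂ free)

      generator : Carrierᴹ
      generator = proj₁ free zero

      generator-primitive : ∀ s → generator *ᵣ s ≈ᴹ 0ᴹ → s ≈ 0#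
      generator-primitive s h = independent (λ _ → s) (≈ᴹ-trans (+ᴹ-identityʳ _) h) zero

      generator∈ : generator ∈ ⟦ submodule ⟧
      generator∈ = members zero

      generates₁ : ∀ {v} → v ∈ ⟦ submodule ⟧ → ∃[ s ] v ≈ᴹ generator *ᵣ s
      generates₁ v∈ with generates v∈
      ... | s , h = s zero , ≈ᴹ-trans h (+ᴹ-identityʳ _)

  place : Point → Place
  place x = proj₁ (representative (generator x) (generator-primitive x))

  vec-place∈ : ∀ x → vec (place x) ∈ ⟦ Point.submodule x ⟧
  vec-place∈ x with representative (generator x) (generator-primitive x)
  ... | _ , t , _ , h , _ = Submodule.respects (Point.submodule x) (≈ᴹ-sym h)
    (Submodule.*ᵣ-closed (Point.submodule x) t (generator∈ x))

  ∈⇒∈span-place : ∀ x {v} → v ∈ ⟦ Point.submodule x ⟧ → v ∈ ⟦ span (vec (place x)) ⟧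
  ∈⇒∈span-place x v∈ with representative (generator x) (generator-primitive x) | generates₁ x v∈
  ... | a , t , u , h , tu≈1 | s , v≈gs = u * s , ≈ᴹ-trans v≈gs
    (≈ᴹ-trans (*ᵣ-congˡ (trans (sym (*-identityˡ s)) (trans (*-congʳ (sym tu≈1)) (*-assoc t u s))))
      (≈ᴹ-trans (≈ᴹ-sym (*ᵣ-assoc (generator x) t (u * s))) (*ᵣ-congʳ (≈ᴹ-sym h))))

  open Setoid pointSetoid using () renaming (_≈_ to _≈ₚ_)

  place-cong : ∀ {x y} → x ≈ₚ y → place x ≡ place y
  place-cong {x} {y} (x⊆y , _) = vec-injective (place x) (place y)
    (proj₂ (∈⇒∈span-place y (x⊆y (vec-place∈ x))))

  span⊆ : ∀ {v} (V : Submodule R³) → v ∈ ⟦ V ⟧ → ∀ {w} → w ∈ ⟦ span v ⟧ → w ∈ ⟦ V ⟧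
  span⊆ V v∈ (s , h) = Submodule.respects V (≈ᴹ-sym h) (Submodule.*ᵣ-closed V s v∈)

  toPoint-place : ∀ x → toPoint (place x) ≈ₚ x
  toPoint-place x = span⊆ (Point.submodule x) (vec-place∈ x) , ∈⇒∈span-place x

  place-toPoint : ∀ a → place (toPoint a) ≡ a
  place-toPoint a = vec-injective (place (toPoint a)) a (proj₂ (vec-place∈ (toPoint a)))

  -- Reduces incidence to one vector, the normalised generator of the point.
  on⇔ : ∀ x (L : Line) → x on L ⇔ vec (place x) ∈ ⟦ Line.submodule L ⟧
  on⇔ x L = mk⇔ on⇒∈ ∈⇒on
    where
    on⇒∈ : x on L → vec (place x) ∈ ⟦ Line.submodule L ⟧
    on⇒∈ x⊆L = x⊆L (vec-place∈ x)

    ∈⇒on : vec (place x) ∈ ⟦ Line.submodule L ⟧ → x on L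
    ∈⇒on v∈L w∈x = span⊆ (Line.submodule L) v∈L (∈⇒∈span-place x w∈x)

-- Normal forms of lines

module Lines {c ℓ} (R : Ring c ℓ) {p} (C : Coordinates R p) where
  open Ring R hiding (zero)
  open RingProperties R
  open CommutativeSemigroupProperties +-commutativeSemigroup using (interchange)
  open Coordinates C
  open CoordinateProperties R C
  open PHG R
  open RightModule R³ using (Carrierᴹ; _≈ᴹ_; _+ᴹ_; _*ᵣ_; 0ᴹ; +ᴹ-identityʳ; +ᴹ-congˡ; +ᴹ-comm; ≈ᴹ-sym; ≈ᴹ-trans)
  open SetoidReasoning setoid

  private
    substitute : ∀ {A B A′ B′ P Q P′ Q′} → A ≈ A′ * P + B′ * Q → B ≈ A′ * P′ + B′ * Q′ →
                 ∀ s t → A * s + B * t ≈ A′ * (P * s + P′ * t) + B′ * (Q * s + Q′ * t)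
    substitute {A} {B} {A′} {B′} {P} {Q} {P′} {Q′} hA hB s t = begin
      A * s + B * t
        ≈⟨ +-cong (*-congʳ hA) (*-congʳ hB) ⟩
      (A′ * P + B′ * Q) * s + (A′ * P′ + B′ * Q′) * t
        ≈⟨ +-cong (distribʳ s _ _) (distribʳ t _ _) ⟩
      (A′ * P * s + B′ * Q * s) + (A′ * P′ * t + B′ * Q′ * t)
        ≈⟨ interchange _ _ _ _ ⟩
      (A′ * P * s + A′ * P′ * t) + (B′ * Q * s + B′ * Q′ * t)
        ≈⟨ +-cong (+-cong (*-assoc _ _ _) (*-assoc _ _ _)) (+-cong (*-assoc _ _ _) (*-assoc _ _ _)) ⟩
      (A′ * (P * s) + A′ * (P′ * t)) + (B′ * (Q * s) + B′ * (Q′ * t))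
        ≈⟨ +-cong (distribˡ A′ _ _) (distribˡ B′ _ _) ⟨
      A′ * (P * s + P′ * t) + B′ * (Q * s + Q′ * t) ∎

    *-cancel-inverse : ∀ A {t u} → t * u ≈ 1# → A * t * u ≈ A
    *-cancel-inverse A {t} {u} tu≈1 = trans (*-assoc A t u) (trans (*-congˡ tu≈1) (*-identityʳ A))

    1s+0t≈s : ∀ {a b} s t → a ≈ 1# → b ≈ 0# → a * s + b * t ≈ s
    1s+0t≈s s t a≈1 b≈0 = trans
      (+-cong (trans (*-congʳ a≈1) (*-identityˡ s)) (trans (*-congʳ b≈0) (zeroˡ t))) (+-identityʳ s)

    0s+1t≈t : ∀ {a b} s t → a ≈ 0# → b ≈ 1# → a * s + b * t ≈ t
    0s+1t≈t s t a≈0 b≈1 = trans (+-comm _ _) (1s+0t≈s t s b≈1 a≈0)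

  -- Coefficients stay on the left throughout, since vectors are scaled on the right and `R` need
  -- not be commutative.
  solveFor : ∀ {α w} → α * w ≈ 1# → w * α ≈ 1# → ∀ β {x y z} →
             z ≈ α * x + β * y ⇔ x ≈ w * z + - (w * β) * y
  solveFor {α} {w} αw≈1 wα≈1 β {x} {y} {z} = mk⇔
    (λ h → begin
      x                                              ≈⟨ move x (w * β * y) ⟨
      (x + w * β * y) + - (w * β * y)                ≈⟨ +-cong (trans (*-congˡ h) expandˡ) (sym (-‿distribˡ-* _ y)) ⟨
      w * z + - (w * β) * y                          ∎)
    (λ h → begin
      z                                              ≈⟨ move′ z (β * y) ⟨
      (z + - (β * y)) + β * y                        ≈⟨ +-congʳ (trans (*-congˡ h) expandʳ) ⟨
      α * x + β * y                                  ∎)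
    where
    move : ∀ a b → (a + b) + - b ≈ a
    move a b = trans (+-assoc a b (- b)) (trans (+-congˡ (-‿inverseʳ b)) (+-identityʳ a))

    move′ : ∀ a b → (a + - b) + b ≈ a
    move′ a b = trans (+-assoc a (- b) b) (trans (+-congˡ (-‿inverseˡ b)) (+-identityʳ a))

    cancel : ∀ {a b} → a * b ≈ 1# → ∀ s → a * (b * s) ≈ s
    cancel ab≈1 s = trans (sym (*-assoc _ _ s)) (trans (*-congʳ ab≈1) (*-identityˡ s))

    expandˡ : w * (α * x + β * y) ≈ x + w * β * y
    expandˡ = trans (distribˡ w _ _) (+-cong (cancel wα≈1 x) (sym (*-assoc w β y)))

    expandʳ : α * (w * z + - (w * β) * y) ≈ z + - (β * y)
    expandʳ = trans (distribˡ α _ _) (+-cong (cancel αw≈1 z)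
      (trans (*-congˡ (sym (-‿distribˡ-* _ y))) (trans (sym (-‿distribʳ-* α _))
        (-‿cong (trans (*-congˡ (*-assoc w β y)) (cancel αw≈1 (β * y)))))))

  -- Abstracts from the coordinate functions, so that one elimination argument serves all orders of
  -- `X`, `Y` and `Z`.
  record Functional : Set (c ⊔ ℓ) where
    field
      _at_   : Carrierᴹ → Carrier
      cong   : ∀ {u v} → u ≈ᴹ v → _at_ u ≈ _at_ v
      linear : ∀ u v s t → _at_ (u *ᵣ s +ᴹ v *ᵣ t) ≈ _at_ u * s + _at_ v * t
      homogeneous : ∀ u s → _at_ (u *ᵣ s) ≈ _at_ u * s

  open Functional using (_at_)

  X Y Z : Functional
  X = record { _at_ = proj₁ ; cong = proj₁
             ; linear = λ _ _ _ _ → refl ; homogeneous = λ _ _ → refl }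
  Y = record { _at_ = proj₁ ∘ proj₂ ; cong = proj₁ ∘ proj₂
             ; linear = λ _ _ _ _ → refl ; homogeneous = λ _ _ → refl }
  Z = record { _at_ = proj₂ ∘ proj₂ ; cong = proj₂ ∘ proj₂
             ; linear = λ _ _ _ _ → refl ; homogeneous = λ _ _ → refl }

  Joint : (x y z : Functional) → Set (c ⊔ ℓ)
  Joint x y z = ∀ {u v} → x at u ≈ x at v → y at u ≈ y at v → z at u ≈ z at v → u ≈ᴹ v

  module _ (V : Submodule R³) where

    Spans : Carrierᴹ → Carrierᴹ → Set (c ⊔ ℓ)
    Spans u v = ∀ {w} → w ∈ ⟦ V ⟧ → ∃[ s ] ∃[ t ] w ≈ᴹ u *ᵣ s +ᴹ v *ᵣ t

    Graph : (α β : Carrier) (x y z : Functional) → Set (c ⊔ ℓ)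
    Graph α β x y z = ∀ v → v ∈ ⟦ V ⟧ ⇔ z at v ≈ α * (x at v) + β * (y at v)

    private
      combination∈ : ∀ {u v} → u ∈ ⟦ V ⟧ → v ∈ ⟦ V ⟧ → ∀ s t → u *ᵣ s +ᴹ v *ᵣ t ∈ ⟦ V ⟧
      combination∈ u∈ v∈ s t = Submodule.+-closed V (Submodule.*ᵣ-closed V s u∈) (Submodule.*ᵣ-closed V t v∈)

      changeBasis : ∀ {u v u′ v′ P Q P′ Q′} → u ≈ᴹ u′ *ᵣ P +ᴹ v′ *ᵣ Q → v ≈ᴹ u′ *ᵣ P′ +ᴹ v′ *ᵣ Q′ →
                    Spans u v → Spans u′ v′
      changeBasis (hu₀ , hu₁ , hu₂) (hv₀ , hv₁ , hv₂) spans w∈ with spans w∈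
      ... | s , t , h = _ , _ , ≈ᴹ-trans h
        (substitute hu₀ hv₀ s t , substitute hu₁ hv₁ s t , substitute hu₂ hv₂ s t)

      swapSpans : ∀ {u v} → Spans u v → Spans v u
      swapSpans spans w∈ with spans w∈
      ... | s , t , h = t , s , ≈ᴹ-trans h (+ᴹ-comm _ _)

      -- This is v - u t s, written as a combination with coefficients 1 and - s so that
      -- `Functional.linear` applies directly.
      cleared : (u v : Carrierᴹ) (t s : Carrier) → Carrierᴹ
      cleared u v t s = v *ᵣ 1# +ᴹ (u *ᵣ t) *ᵣ (- s)

      -- A pivot step of Gaussian elimination: the old vectors are recovered from the new ones as (u
      -- t) b and (u t) s + v′, where v′ is the cleared vector.
      clear : ∀ {u v} t b s → t * b ≈ 1# → Spans u v → Spans (u *ᵣ t) (cleared u v t s)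
      clear {u₀ , u₁ , u₂} {v₀ , v₁ , v₂} t b s tb≈1 =
        changeBasis {P = b} {Q = 0#} {P′ = s} {Q′ = 1#}
          (first u₀ , first u₁ , first u₂) (second u₀ v₀ , second u₁ v₁ , second u₂ v₂)
        where
        first : ∀ A {B} → A ≈ A * t * b + B * 0#
        first A {B} = sym (trans (+-cong (*-cancel-inverse A tb≈1) (zeroʳ B)) (+-identityʳ A))

        second : ∀ A B → B ≈ A * t * s + (B * 1# + A * t * (- s)) * 1#
        second A B = begin
          B                                         ≈⟨ *-identityʳ B ⟨
          B * 1#                                    ≈⟨ x≈y+[x-y] (B * 1#) (A * t * s) ⟩
          A * t * s + (B * 1# + - (A * t * s))      ≈⟨ +-congˡ (+-congˡ (-‿distribʳ-* _ s)) ⟩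
          A * t * s + (B * 1# + A * t * (- s))      ≈⟨ +-congˡ (*-identityʳ _) ⟨
          A * t * s + (B * 1# + A * t * (- s)) * 1# ∎

      at-normalised : ∀ x u {t} → x at u * t ≈ 1# → x at (u *ᵣ t) ≈ 1#
      at-normalised x u h = trans (Functional.homogeneous x u _) h

      at-cleared : ∀ x u v {t} → x at u * t ≈ 1# → x at (cleared u v t (x at v)) ≈ 0#
      at-cleared x u v {t} h = begin
        x at (cleared u v t (x at v))
          ≈⟨ Functional.linear x v (u *ᵣ t) 1# (- (x at v)) ⟩
        x at v * 1# + x at (u *ᵣ t) * (- (x at v))
          ≈⟨ +-cong (*-identityʳ _) (trans (*-congʳ (at-normalised x u h)) (*-identityˡ _)) ⟩
        x at v + - (x at v)
          ≈⟨ -‿inverseʳ _ ⟩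
        0# ∎

      -- As `f` and `g` are dual to `x` and `y`, the coefficients of a member are its own values of
      -- `x` and `y`; applying `z` gives the equation. Conversely, the combination of `f` and `g`
      -- with these coefficients agrees with `v` in all three functionals.
      dualBasis⇒graph : ∀ {x y z} → Joint x y z → ∀ {f g} → f ∈ ⟦ V ⟧ → g ∈ ⟦ V ⟧ → Spans f g →
        x at f ≈ 1# → y at f ≈ 0# → x at g ≈ 0# → y at g ≈ 1# → Graph (z at f) (z at g) x y z
      dualBasis⇒graph {x} {y} {z} joint {f} {g} f∈ g∈ spans xf yf xg yg v = mk⇔ to from
        where
        module x = Functional x
        module y = Functional y
        module z = Functional z

        to : v ∈ ⟦ V ⟧ → z at v ≈ z at f * (x at v) + z at g * (y at v)
        to v∈ with spans v∈
        ... | s , t , h = trans (z.cong h) (trans (z.linear f g s t) (+-cong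
          (*-congˡ (sym (trans (x.cong h) (trans (x.linear f g s t) (1s+0t≈s s t xf xg)))))
          (*-congˡ (sym (trans (y.cong h) (trans (y.linear f g s t) (0s+1t≈t s t yf yg)))))))

        from : z at v ≈ z at f * (x at v) + z at g * (y at v) → v ∈ ⟦ V ⟧
        from h = Submodule.respects V (joint
          (trans (x.linear f g _ _) (1s+0t≈s _ _ xf xg))
          (trans (y.linear f g _ _) (0s+1t≈t _ _ yf yg))
          (trans (z.linear f g _ _) (sym h)))
          (combination∈ f∈ g∈ (x at v) (y at v))

      -- The second pivot, on the `y` value of `v`; since `v` has `x` value 0, it leaves the `x`
      -- values intact.
      clearTwo : ∀ {x y z} → Joint x y z → ∀ {u v} → u ∈ ⟦ V ⟧ → v ∈ ⟦ V ⟧ → Spans u v →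
        x at u ≈ 1# → x at v ≈ 0# → ¬ Nil (y at v) → ∃[ α ] ∃[ β ] Graph α β x y z
      clearTwo {x} {y} {z} joint {u} {v} u∈ v∈ spans xu xv h with inverse h
      ... | w , yw≈1 , wy≈1 = _ , _ , dualBasis⇒graph {x} {y} {z} joint
        (combination∈ u∈ (Submodule.*ᵣ-closed V w v∈) 1# (- (y at u)))
        (Submodule.*ᵣ-closed V w v∈)
        (swapSpans (clear w (y at v) (y at u) wy≈1 (swapSpans spans)))
        (trans (Functional.linear x u (v *ᵣ w) 1# _) (trans (+-cong
          (trans (*-identityʳ _) xu) (trans (*-congʳ xvw≈0) (zeroˡ _))) (+-identityʳ 1#)))
        (at-cleared y v u yw≈1)
        xvw≈0
        (at-normalised y v yw≈1)
        where
        xvw≈0 : x at (v *ᵣ w) ≈ 0#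
        xvw≈0 = trans (Functional.homogeneous x v w) (trans (*-congʳ xv) (zeroˡ w))

      swapJoint : ∀ {x y z} → Joint x y z → Joint x z y
      swapJoint joint hx hz hy = joint hx hy hz

    module _ (free : IsFreeOfRank 2 V) where

      open IsBasis (proj₂ free)

      private
        e₀ e₁ : Carrierᴹ
        e₀ = proj₁ free zero
        e₁ = proj₁ free (suc zero)

        independent₂ : ∀ s t → e₀ *ᵣ s +ᴹ e₁ *ᵣ t ≈ᴹ 0ᴹ → s ≈ 0# × t ≈ 0#
        independent₂ s t h = ind zero , ind (suc zero)
          where
          s,t : Fin 2 → Carrier
          s,t zero = s
          s,t (suc _) = t

          ind : ∀ i → s,t i ≈ 0#
          ind = independent s,t (≈ᴹ-trans (+ᴹ-congˡ (+ᴹ-identityʳ _)) h)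

        spans : Spans e₀ e₁
        spans w∈ with generates w∈
        ... | s , h = s zero , s (suc zero) , ≈ᴹ-trans h (+ᴹ-congˡ (+ᴹ-identityʳ _))

      -- After the pivot on `x`, the second vector has `x` value 0. If its other two values were
      -- both nil, `π` would kill it, against independence; so one of them can serve as the second
      -- pivot.
      graph : ∀ {x y z} → Joint x y z → ¬ Nil (x at e₀) →
              (∃[ α ] ∃[ β ] Graph α β x y z) ⊎ (∃[ α ] ∃[ β ] Graph α β x z y)
      graph {x} {y} {z} joint h with inverse h
      ... | t , xt≈1 , tx≈1 = cases (nil? (y at v)) (nil? (z at v))
        where
        u v : Carrierᴹ
        u = e₀ *ᵣ t
        v = cleared e₀ e₁ t (x at e₁)

        u∈ : u ∈ ⟦ V ⟧
        u∈ = Submodule.*ᵣ-closed V t (members zero)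

        v∈ : v ∈ ⟦ V ⟧
        v∈ = combination∈ (members (suc zero)) u∈ 1# _

        u,v-span : Spans u v
        u,v-span = clear t (x at e₀) (x at e₁) tx≈1 spans

        xu : x at u ≈ 1#
        xu = at-normalised x e₀ xt≈1

        xv : x at v ≈ 0#
        xv = at-cleared x e₀ e₁ xt≈1

        component : ∀ A B s → A * (t * s * π) + B * π ≈ (B * 1# + A * t * s) * π
        component A B s = begin
          A * (t * s * π) + B * π          ≈⟨ +-comm _ _ ⟩
          B * π + A * (t * s * π)          ≈⟨ +-cong (*-congʳ (sym (*-identityʳ B)))
                                                (trans (sym (*-assoc A (t * s) π)) (*-congʳ (sym (*-assoc A t s)))) ⟩
          B * 1# * π + A * t * s * π       ≈⟨ distribʳ π _ _ ⟨
          (B * 1# + A * t * s) * π         ∎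

        vπ≉0 : ¬ v *ᵣ π ≈ᴹ 0ᴹ
        vπ≉0 (h₀ , h₁ , h₂) = π≉0 (proj₂ (independent₂ (t * - (x at e₁) * π) π
          (trans (component _ _ _) h₀ , trans (component _ _ _) h₁ , trans (component _ _ _) h₂)))

        cases : Dec (Nil (y at v)) → Dec (Nil (z at v)) → _
        cases (no ny) _ = inj₁ (clearTwo {x} {y} {z} joint u∈ v∈ u,v-span xu xv ny)
        cases (yes hy) (no nz) = inj₂ (clearTwo {x} {z} {y} (swapJoint {x} {y} {z} joint) u∈ v∈ u,v-span xu xv nz)
        cases (yes hy) (yes hz) = ⊥-elim (vπ≉0 (joint
          (trans (Functional.homogeneous x v π) (trans (*-congʳ xv) (trans (zeroˡ π) (sym (at-0 x)))))
          (trans (Functional.homogeneous y v π) (trans (nil-* hy π-nil) (sym (at-0 y))))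
          (trans (Functional.homogeneous z v π) (trans (nil-* hz π-nil) (sym (at-0 z))))))
          where
          at-0 : ∀ w → w at 0ᴹ ≈ 0#
          at-0 w = trans (Functional.cong w (≈ᴹ-sym (zeroʳ _ , zeroʳ _ , zeroʳ _)))
            (trans (Functional.homogeneous w 0ᴹ 0#) (zeroʳ _))

      -- The lines y = αx + βz, x = αy + βz and z = αx + βy, with nil coefficients where a unit
      -- would allow an earlier form. The lines of the last kind are the neighbours of the line at
      -- infinity z = 0.
      data Equation : Set (c ⊔ ℓ) where
        slope : ∀ α β → Graph α β X Z Y → Equation
        steep : ∀ α β → Nil α → Graph α β Y Z X → Equation
        far   : ∀ α β → Nil α → Nil β → Graph α β X Y Z → Equation

      private
        resolve : ∀ {α β x y z w} → α * w ≈ 1# → w * α ≈ 1# →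
                  Graph α β x y z → Graph w (- (w * β)) z y x
        resolve αw wα graph v = mk⇔
          (λ v∈ → Equivalence.to (solveFor αw wα _) (Equivalence.to (graph v) v∈))
          (λ h → Equivalence.from (graph v) (Equivalence.from (solveFor αw wα _) h))

        commute : ∀ {α β x y z} → Graph α β x y z → Graph β α y x z
        commute graph v = mk⇔
          (λ v∈ → trans (Equivalence.to (graph v) v∈) (+-comm _ _))
          (λ h → Equivalence.from (graph v) (trans h (+-comm _ _)))

        fromX : ∀ {α β} → Graph α β Y Z X → Equation
        fromX {α} {β} g with nil? α
        ... | yes h = steep α β h g
        ... | no h with inverse h
        ...   | w , αw , wα = slope w (- (w * β)) (resolve {α} {β} {Y} {Z} {X} αw wα g)

        fromZ : ∀ {α β} → Graph α β X Y Z → Equation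
        fromZ {α} {β} g with nil? β
        ... | no h with inverse h
        ...   | w , βw , wβ = slope _ _ (commute {w} { - (w * α)} {Z} {X} {Y}
                  (resolve {β} {α} {Y} {X} {Z} βw wβ (commute {α} {β} {X} {Y} {Z} g)))
        fromZ {α} {β} g | yes h with nil? α
        ... | yes h′ = far α β h′ h g
        ... | no h′ with inverse h′
        ...   | w , αw , wα = steep _ w (nil-neg (nil-*ˡ w h)) (commute {w} { - (w * β)} {Z} {Y} {X}
                  (resolve {α} {β} {X} {Y} {Z} αw wα g))

      -- Pivots on the first unit coordinate of `e₀` in the order x, y, z; `fromX` and `fromZ` then
      -- solve for another coordinate whenever its coefficient is a unit.
      equation : Equation
      equation with nil? (X at e₀) | nil? (Y at e₀) | nil? (Z at e₀)
      ... | no h | _ | _ with graph {X} {Y} {Z} (λ hx hy hz → hx , hy , hz) h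
      ...   | inj₁ (α , β , g) = fromZ g
      ...   | inj₂ (α , β , g) = slope α β g
      equation | yes _ | no h | _ with graph {Y} {Z} {X} (λ hy hz hx → hx , hy , hz) h
      ...   | inj₁ (α , β , g) = fromX g
      ...   | inj₂ (α , β , g) = fromZ (commute {α} {β} {Y} {X} {Z} g)
      equation | yes _ | yes _ | no h with graph {Z} {X} {Y} (λ hz hx hy → hx , hy , hz) h
      ...   | inj₁ (α , β , g) = slope β α (commute {α} {β} {Z} {X} {Y} g)
      ...   | inj₂ (α , β , g) = fromX (commute {α} {β} {Z} {Y} {X} g)
      -- Without a unit coordinate `e₀` would be killed by `π`.
      equation | yes hx | yes hy | yes hz = ⊥-elim (π≉0 (proj₁ (independent₂ π 0#
        (vanish hx , vanish hy , vanish hz))))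
        where
        vanish : ∀ {a b} → Nil a → a * π + b * 0# ≈ 0#
        vanish h = trans (+-cong (nil-* h π-nil) (zeroʳ _)) (+-identityʳ 0#)

-- Sums over points as sums over places

module PointSums {c ℓ} (R : Ring c ℓ) {p} (C : Coordinates R p) where
  open PHG R
  open Points R C
  open Setoid pointSetoid using () renaming (_≈_ to _≈ₚ_; refl to ≈ₚ-refl)

  private
    F : List (Fin (ℕ.suc p))
    F = allFin (ℕ.suc p)

    F² : List (Fin (ℕ.suc p) × Fin (ℕ.suc p))
    F² = cartesianProduct F F

    F! : Unique F
    F! = Unique.allFin⁺ (ℕ.suc p)

    F²! : Unique F²
    F²! = Unique.cartesianProduct⁺ F! F!

    aff′ : Fin (ℕ.suc p) × Fin (ℕ.suc p) → Fin (ℕ.suc p) × Fin (ℕ.suc p) → Place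
    aff′ (i , k) (l , m) = aff i k l m

    inf′ : Fin (ℕ.suc p) × Fin (ℕ.suc p) → Fin (ℕ.suc p) → Place
    inf′ (i , k) m = inf i k m

    affs infs vers : List Place
    affs = cartesianProductWith aff′ F² F²
    infs = cartesianProductWith inf′ F² F
    vers = cartesianProductWith ver F F

  places : List Place
  places = affs ++ infs ++ vers

  places-unique : Unique places
  places-unique = Unique.++⁺
    (Unique.cartesianProductWith⁺ aff′ (λ { ≡.refl → ≡.refl , ≡.refl }) F²! F²!)
    (Unique.++⁺
      (Unique.cartesianProductWith⁺ inf′ (λ { ≡.refl → ≡.refl , ≡.refl }) F²! F!)
      (Unique.cartesianProductWith⁺ ver (λ { ≡.refl → ≡.refl , ≡.refl }) F! F!)
      (λ (a∈ , a∈′) → inf≢ver a∈ a∈′))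
    (λ (a∈ , a∈′) → aff≢ a∈ a∈′)
    where
    inf≢ver : ∀ {a} → a ∈ˡ infs → ¬ a ∈ˡ vers
    inf≢ver a∈ a∈′ with ∈-cartesianProductWith⁻ inf′ F² F a∈ | ∈-cartesianProductWith⁻ ver F F a∈′
    ... | _ , _ , _ , _ , ≡.refl | _ , _ , _ , _ , ()

    aff≢ : ∀ {a} → a ∈ˡ affs → ¬ a ∈ˡ infs ++ vers
    aff≢ a∈ a∈′ with ∈-cartesianProductWith⁻ aff′ F² F² a∈ | ∈-++⁻ infs a∈′
    ... | _ , _ , _ , _ , ≡.refl | inj₁ h with ∈-cartesianProductWith⁻ inf′ F² F h
    ...   | _ , _ , _ , _ , ()
    aff≢ a∈ a∈′ | _ , _ , _ , _ , ≡.refl | inj₂ h with ∈-cartesianProductWith⁻ ver F F h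
    ...   | _ , _ , _ , _ , ()

  ∈-places : ∀ a → a ∈ˡ places
  ∈-places (aff i k l m) = ∈-++⁺ˡ (∈-cartesianProductWith⁺ aff′
    (∈-cartesianProduct⁺ (∈-allFin i) (∈-allFin k)) (∈-cartesianProduct⁺ (∈-allFin l) (∈-allFin m)))
  ∈-places (inf i k m) = ∈-++⁺ʳ affs (∈-++⁺ˡ (∈-cartesianProductWith⁺ inf′
    (∈-cartesianProduct⁺ (∈-allFin i) (∈-allFin k)) (∈-allFin m)))
  ∈-places (ver a b) = ∈-++⁺ʳ affs (∈-++⁺ʳ infs (∈-cartesianProductWith⁺ ver (∈-allFin a) (∈-allFin b)))

  sumAff sumInf sumVer sumPlaces : (Place → ℕ) → ℕ
  sumAff f = ∑ λ i → ∑ λ k → ∑ λ l → ∑ λ m → f (aff i k l m)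
  sumInf f = ∑ λ i → ∑ λ k → ∑ λ m → f (inf i k m)
  sumVer f = ∑ λ a → ∑ λ b → f (ver a b)
  sumPlaces f = sumAff f ℕ.+ (sumInf f ℕ.+ sumVer f)

  sum-places : ∀ f → sum (map f places) ≡ sumPlaces f
  sum-places f = ≡.trans (sum-map-++ f affs _) (≡.cong₂ ℕ._+_ sum-affs
    (≡.trans (sum-map-++ f infs vers) (≡.cong₂ ℕ._+_ sum-infs sum-vers)))
    where
    sum-F : ∀ g → sum (map g F) ≡ ∑ g
    sum-F g = sum-map-tabulate g id

    sum-F² : ∀ g → sum (map g F²) ≡ ∑ λ i → ∑ λ k → g (i , k)
    sum-F² g = ≡.trans (sum-map-product g _,_ F F) (≡.trans (sum-F λ i → sum (map (λ k → g (i , k)) F))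
      (∑-cong λ i → sum-F λ k → g (i , k)))

    sum-affs : sum (map f affs) ≡ sumAff f
    sum-affs = ≡.trans (sum-map-product f aff′ F² F²)
      (≡.trans (sum-F² λ x → sum (map (f ∘ aff′ x) F²))
        (∑-cong λ i → ∑-cong λ k → sum-F² (f ∘ aff′ (i , k))))

    sum-infs : sum (map f infs) ≡ sumInf f
    sum-infs = ≡.trans (sum-map-product f inf′ F² F)
      (≡.trans (sum-F² λ x → sum (map (f ∘ inf′ x) F))
        (∑-cong λ i → ∑-cong λ k → sum-F (f ∘ inf i k)))

    sum-vers : sum (map f vers) ≡ sumVer f
    sum-vers = ≡.trans (sum-map-product f ver F F)
      (≡.trans (sum-F λ a → sum (map (f ∘ ver a) F))
        (∑-cong λ a → sum-F (f ∘ ver a)))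

  -- Since `place` and `toPoint` are inverse to each other up to equality of points, the filtered
  -- list of places is carried to a repetition-free list of exactly the points satisfying `P`.
  sumOver : ∀ {r s} {P : Pred Point r} {Q : Pred Place s} (Q? : Decidable Q) (K : Place → ℕ) →
            (∀ x → P x ⇔ Q (place x)) → SumOver P (K ∘ place) (sumPlaces λ a → restrict (Q? a) (K a))
  sumOver {P = P} {Q} Q? K P⇔Q = map toPoint as
    , Uniqueₛ.map⁺ (≡.setoid Place) pointSetoid (λ {a} {b} eq → ≡.trans (≡.sym (place-toPoint a))
        (≡.trans (place-cong {toPoint a} {toPoint b} eq) (place-toPoint b))) (Unique.filter⁺ Q? places-unique)
    , (λ x → mk⇔ (to x) (from x))
    , (begin
        sum (map (K ∘ place) (map toPoint as))           ≡⟨ ≡.cong sum (List.map-∘ as) ⟨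
        sum (map (K ∘ place ∘ toPoint) as)               ≡⟨ ≡.cong sum (List.map-cong (λ a → ≡.cong K (place-toPoint a)) as) ⟩
        sum (map K as)                                   ≡⟨ sum-map-filter Q? K places ⟩
        sum (map (λ a → restrict (Q? a) (K a)) places)   ≡⟨ sum-places _ ⟩
        sumPlaces (λ a → restrict (Q? a) (K a))          ∎)
    where
    open ≡.≡-Reasoning
    open import Data.List.Membership.Setoid pointSetoid using () renaming (_∈_ to _∈ₗ_)

    as : List Place
    as = filter Q? places

    to : ∀ x → P x → x ∈ₗ map toPoint as
    to x Px = Membershipₛ.∈-resp-≈ pointSetoid {xs = map toPoint as} {toPoint (place x)} {x} (toPoint-place x)
      (Membershipₛ.∈-map⁺ (≡.setoid Place) pointSetoid {f = toPoint} toPoint-cong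
        (∈-filter⁺ Q? (∈-places (place x)) (Equivalence.to (P⇔Q x) Px)))
      where
      toPoint-cong : ∀ {a b} → a ≡ b → toPoint a ≈ₚ toPoint b
      toPoint-cong {a} ≡.refl = ≈ₚ-refl {toPoint a}

    from : ∀ x → x ∈ₗ map toPoint as → P x
    from x x∈ with Membershipₛ.∈-map⁻ (≡.setoid Place) pointSetoid {v = x} {xs = as} {f = toPoint} x∈
    ... | a , a∈ , x≈ = Equivalence.from (P⇔Q x) (≡.subst Q
      (≡.sym (≡.trans (place-cong {x} {toPoint a} x≈) (place-toPoint a))) (proj₂ (∈-filter⁻ Q? {xs = places} a∈)))

-- Linear equations in coordinates

module Congruences {c ℓ} (R : Ring c ℓ) {p} (C : Coordinates R p) where
  open Ring R hiding (zero)
  open RingProperties R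
  open Coordinates C
  open CoordinateProperties R C

  ⟨⟩≈⇒ : ∀ {i k y} → ⟨ i , k ⟩ ≈ y → i ≡ res y × k ≡ ι y
  ⟨⟩≈⇒ {y = y} eq = ⟨⟩-injective (trans eq (expand y))

  ρ≈⇒ : ∀ {k y} → ρ k ≈ y → k ≡ ι y
  ρ≈⇒ {k} eq = ≡.trans (≡.sym (ι-ρ k)) (ι-cong eq)

  infix 4 _≈?_
  abstract
    _≈?_ : Decidable₂ _≈_
    x ≈? y = Dec.map′
      (λ (hr , hι) → trans (expand x) (trans (reflexive (≡.cong₂ ⟨_,_⟩ hr hι)) (sym (expand y))))
      (λ eq → res-cong eq , ι-cong eq)
      ((res x Fin.≟ res y) Dec.×-dec (ι x Fin.≟ ι y))

  res-+-nil : ∀ x {y} → Nil y → res (x + y) ≡ res x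
  res-+-nil x {y} h = nil⇒res (nil-resp (sym ([x+y]-x≈y x y)) h)

  nil*⟨⟩ : ∀ {α} → Nil α → ∀ i k → α * ⟨ i , k ⟩ ≈ α * τ i
  nil*⟨⟩ h i k = *-nil-cong h (≡.trans (res-⟨⟩ i k) (≡.sym (res-τ i)))

  -- A nil factor sees only the residue of the other one, so the quotient may be taken in the
  -- transversal.
  divideτ : ∀ {x y} → Nil x → ¬ x ≈ 0# → Nil y → ∃[ i ] x * τ i ≈ y
  divideτ h x≉0 h′ with divide h x≉0 h′
  ... | s , y≈xs = res s , sym (trans y≈xs (*-nil-cong h (≡.sym (res-τ (res s)))))

  unit*-cancel : ∀ {u} → ¬ Nil u → ∀ {x y} → u * x ≈ u * y → x ≈ y
  unit*-cancel {u} h {x} {y} eq with inverse h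
  ... | v , _ , vu≈1 = trans (sym (cancel x)) (trans (*-congˡ eq) (cancel y))
    where
    cancel : ∀ z → v * (u * z) ≈ z
    cancel z = trans (sym (*-assoc v u z)) (trans (*-congʳ vu≈1) (*-identityˡ z))

  -- For a unit `u`, the product u ρ k runs once through the radical, so exactly one `k` moves `ω`
  -- to the element of its residue class with digit 0. This is why a line meets a segment of another
  -- direction exactly once.
  ι-translate : ∀ {u} → ¬ Nil u → ∀ ω → ∃[ k₀ ] ∀ k → ι (ω + u * ρ k) ≡ zero ⇔ k ≡ k₀
  ι-translate {u} h ω with inverse h
  ... | v , uv≈1 , _ = k₀ , λ k → mk⇔ (unique k) (λ { ≡.refl → hit })
    where
    ν : Carrier
    ν = τ (res ω) - ω

    ν-nil : Nil ν
    ν-nil = res⇒nil (res-τ (res ω))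

    k₀ : Fin (ℕ.suc p)
    k₀ = ι (v * ν)

    uρk₀≈ν : u * ρ k₀ ≈ ν
    uρk₀≈ν = trans (*-congˡ (sym (nil-expand (nil-*ˡ v ν-nil))))
      (trans (sym (*-assoc u v ν)) (trans (*-congʳ uv≈1) (*-identityˡ ν)))

    ω+ν : ω + ν ≈ ⟨ res ω , zero ⟩
    ω+ν = trans (sym (x≈y+[x-y] (τ (res ω)) ω)) (trans (sym (+-identityʳ _)) (+-congˡ (sym ρ-zero)))

    hit : ι (ω + u * ρ k₀) ≡ zero
    hit = ≡.trans (ι-cong (trans (+-congˡ uρk₀≈ν) ω+ν)) (ι-⟨⟩ (res ω) zero)

    unique : ∀ k → ι (ω + u * ρ k) ≡ zero → k ≡ k₀
    unique k eq = ρ-injective (unit*-cancel h (+-cancelˡ ω _ _ (trans (expand _)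
      (trans (reflexive (≡.cong₂ ⟨_,_⟩ (res-+-nil ω (nil-*ˡ u (ρ-nil k))) eq))
        (trans (sym ω+ν) (+-congˡ (sym uρk₀≈ν)))))))

-- Arcs described by places

module ArcCriterion {c ℓ} (R : Ring c ℓ) {p} (C : Coordinates R p) where
  open Ring R hiding (zero)
  open PHG R
  open Congruences R C
  open Points R C
  open PointSums R C
  open Lines R C
  open Functional using (_at_)

  graph? : ∀ α β (x y z : Functional) → Decidable (λ a → z at vec a ≈ α * (x at vec a) + β * (y at vec a))
  graph? α β x y z a = z at vec a ≈? α * (x at vec a) + β * (y at vec a)

  graphSum : (α β : Carrier) (x y z : Functional) → (Place → ℕ) → ℕ
  graphSum α β x y z K = sumPlaces λ a → restrict (graph? α β x y z a) (K a)

  slopeSum steepSum farSum : (Place → ℕ) → Carrier → Carrier → ℕ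
  slopeSum K α β = graphSum α β X Z Y K
  steepSum K α β = graphSum α β Y Z X K
  farSum   K α β = graphSum α β X Y Z K

  -- Every line has one of the three equations, so bounding the three families of sums covers all
  -- lines.
  projectiveArc : ∀ {k n} (K : Place → ℕ) → (∀ a → K a ≡ 0 ⊎ K a ≡ 1) → sumPlaces K ≡ k →
    (∀ α β → slopeSum K α β ≤ n) →
    (∀ α β → Coordinates.Nil C α → steepSum K α β ≤ n) →
    (∀ α β → Coordinates.Nil C α → Coordinates.Nil C β → farSum K α β ≤ n) →
    HasProjectiveArc k n
  projectiveArc {k} {n} K K-01 total slope≤ steep≤ far≤ = K ∘ place , record
    { respects = λ {x} {y} x≈y → ≡.cong K (place-cong {x} {y} x≈y)
    ; total    = ≡.subst (SumOver U (K ∘ place)) total (sumOver {P = U} {λ _ → ⊤} (λ _ → yes tt) K (λ _ → mk⇔ _ _))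
    ; secants  = secant
    } , K-01 ∘ place
    where
    onGraph : ∀ L {α β x y z} → Graph (Line.submodule L) α β x y z → SumOver (_on L) (K ∘ place) (graphSum α β x y z K)
    onGraph L {α} {β} {x} {y} {z} graph = sumOver (graph? α β x y z) K (λ w → graph (vec (place w)) ⇔-∘ on⇔ w L)

    secant : ∀ L → ∃[ s ] SumOver (_on L) (K ∘ place) s × s ≤ n
    secant L with equation (Line.submodule L) (Line.free L)
    ... | slope α β graph       = slopeSum K α β , onGraph L {α} {β} {X} {Z} {Y} graph , slope≤ α β
    ... | steep α β hα graph    = steepSum K α β , onGraph L {α} {β} {Y} {Z} {X} graph , steep≤ α β hα
    ... | far   α β hα hβ graph = farSum K α β   , onGraph L {α} {β} {X} {Y} {Z} graph , far≤ α β hα hβ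

-- A neighbour class as an arc

module PointClass {c ℓ} (R : Ring c ℓ) {p} (C : Coordinates R p) where
  open Ring R using (1#; _*_; _+_; sym)
  open PHG R
  open Coordinates C
  open CoordinateProperties R C
  open Congruences R C
  open Points R C
  open PointSums R C
  open Lines R C using (Functional; X; Y; Z)
  open ArcCriterion R C

  private
    q : ℕ
    q = ℕ.suc p

    K : Place → ℕ
    K (aff i k l m) = 0
    K (inf i k m)   = 0
    K (ver a b)     = 1

    K-01 : ∀ a → K a ≡ 0 ⊎ K a ≡ 1
    K-01 (aff i k l m) = inj₁ ≡.refl
    K-01 (inf i k m)   = inj₁ ≡.refl
    K-01 (ver a b)     = inj₂ ≡.refl

    sumAff-0 : ∀ {f} → (∀ i k l m → f (aff i k l m) ≡ 0) → sumAff f ≡ 0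
    sumAff-0 h = ∑-zero λ i → ∑-zero λ k → ∑-zero λ l → ∑-zero λ m → h i k l m

    sumInf-0 : ∀ {f} → (∀ i k m → f (inf i k m) ≡ 0) → sumInf f ≡ 0
    sumInf-0 h = ∑-zero λ i → ∑-zero λ k → ∑-zero λ m → h i k m

    restrict-0 : ∀ {r} {P : Set r} (P? : Dec P) → restrict P? 0 ≡ 0
    restrict-0 (yes _) = ≡.refl
    restrict-0 (no _)  = ≡.refl

    sum-ver : ∀ α β x y z → graphSum α β x y z K ≡ ∑ (λ a → ∑ λ b → restrict (graph? α β x y z (ver a b)) 1)
    sum-ver α β x y z = ≡.cong₂ ℕ._+_
      (sumAff-0 {λ a → restrict (graph? α β x y z a) (K a)} λ i k l m → restrict-0 (graph? α β x y z (aff i k l m)))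
      (≡.cong (ℕ._+ ∑ (λ a → ∑ λ b → restrict (graph? α β x y z (ver a b)) 1))
        (sumInf-0 {λ a → restrict (graph? α β x y z a) (K a)} λ i k m → restrict-0 (graph? α β x y z (inf i k m))))

    count : ∑ {q} (λ _ → 1) ≡ q
    count = ≡.trans (∑-const q 1) (ℕ.*-identityʳ q)

    slope≤ : ∀ α β → slopeSum K α β ≤ q
    slope≤ α β = ℕ.≤-trans (ℕ.≤-reflexive (≡.trans (sum-ver α β X Z Y) (∑-zero λ a → ∑-zero λ b →
      restrict-no (1# ≈? α * ρ a + β * ρ b)
        (λ eq → 1-unit (nil-resp (sym eq) (nil-+ (nil-*ˡ α (ρ-nil a)) (nil-*ˡ β (ρ-nil b)))))))) z≤n

    steep≤ : ∀ α β → Nil α → steepSum K α β ≤ q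
    steep≤ α β h = ℕ.≤-reflexive (≡.trans (sum-ver α β Y Z X) (≡.trans
      (∑-comm λ a b → restrict (ρ a ≈? α * 1# + β * ρ b) 1)
      (≡.trans (∑-cong λ b → ∑-restrict (λ a → ρ a ≈? α * 1# + β * ρ b) (λ _ → 1) ρ≈⇒
        (sym (nil-expand (nil-+ (nil-*ʳ 1# h) (nil-*ˡ β (ρ-nil b)))))) count)))

    far≤ : ∀ α β → Nil α → Nil β → farSum K α β ≤ q
    far≤ α β hα hβ = ℕ.≤-reflexive (≡.trans (sum-ver α β X Y Z)
      (≡.trans (∑-cong λ a → ∑-restrict (λ b → ρ b ≈? α * ρ a + β * 1#) (λ _ → 1) ρ≈⇒
        (sym (nil-expand (nil-+ (nil-*ʳ (ρ a) hα) (nil-*ʳ 1# hβ))))) count))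

  -- Lines of the form `slope` miss the class of the vertical point at infinity; all others meet it
  -- in `q` points.
  pointClassArc : HasProjectiveArc (q ℕ.* q) q
  pointClassArc = projectiveArc K K-01
    (≡.cong₂ ℕ._+_ (sumAff-0 {K} λ _ _ _ _ → ≡.refl) (≡.cong₂ ℕ._+_ (sumInf-0 {K} λ _ _ _ → ≡.refl)
      (≡.trans (∑-cong λ _ → count) (∑-const q q))))
    slope≤ steep≤ far≤

-- The point set for q at least 3

module Arc {c ℓ} (R : Ring c ℓ) {p} (C : Coordinates R (2 ℕ.+ p)) (d : ℕ) where
  open Ring R hiding (zero)
  open RingProperties R
  open Coordinates C
  open CoordinateProperties R C
  open Congruences R C
  open Points R C
  open PointSums R C
  open ArcCriterion R C

  private
    q : ℕ
    q = 3 ℕ.+ p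

  -- Column i of the affine plane and the class of points at infinity on lines
  -- of slope τ i share the index i; column i lacks the segments of direction
  -- τ i exactly when i is special.
  special : Fin q → Bool
  special i = toℕ i <ᵇ d

  -- A point at infinity of slope `τ i` on the line z = ρ b y has z ≈ ρ b τ i. For i = 0 these
  -- values would all collapse to 0; the factor 1 keeps them distinct.
  multiplier : Fin q → Carrier
  multiplier 0F      = 1#
  multiplier (suc i) = τ (suc i)

  -- The hits ρ i τ i for i ≥ d + 2 meet the lines z = β y, β = ρ i, at infinity,
  -- which the pencils of the first two hits and inVer leave with one hit only;
  -- the values at 0 and 1 are mere padding.
  third : Fin q → Fin q
  third 0F            = 2F
  third 1F            = 2F
  third (suc (suc i)) = suc (suc i)

  -- Letting the second removed segment of class `l` have digit `l` catches the lines x = β whose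
  -- digit is not 0. The value at 0 only has to differ from the first segment, which has digit 0.
  second : Fin q → Fin q
  second 0F      = 1F
  second (suc l) = suc l

  gap : Bool → Fin q → List (Fin q)
  gap true  i = 0F ∷ 1F ∷ []
  gap false i = 0F ∷ 1F ∷ third i ∷ []

  -- ρ b * multiplier i ≈ ρ (twist i b)
  twist : Fin q → Fin q → Fin q
  twist i b = res (τ b * multiplier i)

  -- Removed from the class of (τ i, τ l) are the vertical segments on which x has digit 0 or
  -- `second l`, respectively the segment on which y - τ i x has digit 0.
  inColumn : Bool → (i k l m : Fin q) → ℕ
  inColumn true  i k l m = outside (0F ∷ second l ∷ []) k
  inColumn false i k l m = outside (0F ∷ []) (ι (⟨ l , m ⟩ - τ i * ⟨ i , k ⟩))

  inGap : Fin q → Fin q → ℕ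
  inGap i = outside (map (twist i) (gap (special i) i))

  inVer : Fin q → ℕ
  inVer b = if toℕ b <ᵇ 2 ℕ.+ d then 0 else 1

  inArc : Place → ℕ
  inArc (aff i k l m) = inColumn (special i) i k l m
  inArc (inf i k m)   = inGap i m
  inArc (ver a b)     = inVer b

  inVer-01 : ∀ b → inVer b ≡ 0 ⊎ inVer b ≡ 1
  inVer-01 b with toℕ b <ᵇ 2 ℕ.+ d
  ... | true  = inj₁ ≡.refl
  ... | false = inj₂ ≡.refl

  inColumn-01 : ∀ b i k l m → inColumn b i k l m ≡ 0 ⊎ inColumn b i k l m ≡ 1
  inColumn-01 true  i k l m = outside-01 (0F ∷ second l ∷ []) k
  inColumn-01 false i k l m = outside-01 (0F ∷ []) (ι (⟨ l , m ⟩ - τ i * ⟨ i , k ⟩))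

  inArc-01 : ∀ a → inArc a ≡ 0 ⊎ inArc a ≡ 1
  inArc-01 (aff i k l m) = inColumn-01 (special i) i k l m
  inArc-01 (inf i k m)   = outside-01 (map (twist i) (gap (special i) i)) m
  inArc-01 (ver a b)     = inVer-01 b

  multiplier-unit : ∀ i → ¬ Nil (multiplier i)
  multiplier-unit 0F      h = 1-unit h
  multiplier-unit (suc i) h = contradiction (≡.trans (≡.sym (res-τ (suc i))) h) λ ()

  nil-cancel-unit : ∀ {x u} → ¬ Nil u → Nil (x * u) → Nil x
  nil-cancel-unit {x} {u} h xu with inverse h
  ... | v , uv≈1 , _ = nil-resp (trans (*-assoc x u v) (trans (*-congˡ uv≈1) (*-identityʳ x))) (nil-*ʳ v xu)

  twist-injective : ∀ i {b b′} → twist i b ≡ twist i b′ → b ≡ b′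
  twist-injective i {b} {b′} eq = ≡.trans (≡.sym (res-τ b)) (≡.trans (nil⇒res (nil-cancel-unit (multiplier-unit i)
    (nil-resp (sym ([y-z]x≈yx-zx (multiplier i) (τ b) (τ b′))) (res⇒nil eq)))) (res-τ b′))

  0≢third : ∀ i → 0F ≢ third i
  0≢third 0F            ()
  0≢third 1F            ()
  0≢third (suc (suc i)) ()

  1≢third : ∀ i → 1F ≢ third i
  1≢third 0F            ()
  1≢third 1F            ()
  1≢third (suc (suc i)) ()

  gap-unique : ∀ b i → Unique (gap b i)
  gap-unique true  i = ((λ ()) ∷ []) ∷ [] ∷ []
  gap-unique false i = ((λ ()) ∷ 0≢third i ∷ []) ∷ (1≢third i ∷ []) ∷ [] ∷ []

  second-unique : ∀ l → Unique (0F ∷ second l ∷ [])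
  second-unique 0F      = ((λ ()) ∷ []) ∷ [] ∷ []
  second-unique (suc l) = ((λ ()) ∷ []) ∷ [] ∷ []

  -- Size of the point set

  ∑-outside-length : ∀ {xs : List (Fin q)} n → Unique xs → length xs ℕ.+ n ≡ q → ∑ (outside xs) ≡ n
  ∑-outside-length {xs} n xs! eq = ℕ.+-cancelʳ-≡ (length xs) _ _
    (≡.trans (∑-outside xs!) (≡.trans (≡.sym eq) (ℕ.+-comm (length xs) n)))

  ∑-second : ∀ l → ∑ (outside (0F ∷ second l ∷ [])) ≡ 1 ℕ.+ p
  ∑-second l = ∑-outside-length (1 ℕ.+ p) (second-unique l) ≡.refl

  ∑-gap : ∀ b i → ∑ (outside (map (twist i) (gap b i))) ≡ (if b then 1 ℕ.+ p else p)
  ∑-gap true  i = ∑-outside-length (1 ℕ.+ p) (Unique.map⁺ (twist-injective i) (gap-unique true i)) ≡.refl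
  ∑-gap false i = ∑-outside-length p (Unique.map⁺ (twist-injective i) (gap-unique false i)) ≡.refl

  ∑-translate : ∀ {u} → ¬ Nil u → ∀ ω → ∑ (λ k → outside (0F ∷ []) (ι (ω + u * ρ k))) ≡ 2 ℕ.+ p
  ∑-translate h ω with ι-translate h ω
  ... | k₀ , hit⇔ = ≡.trans (∑-cong λ k → outside-singleton (hit⇔ k))
    (∑-outside-length {k₀ ∷ []} (2 ℕ.+ p) ([] ∷ []) ≡.refl)

  [τ+ρ]-z : ∀ l m z → ⟨ l , m ⟩ - z ≈ (τ l - z) + 1# * ρ m
  [τ+ρ]-z l m z = trans (+-assoc _ _ _) (trans (+-congˡ (+-comm _ _)) (trans (sym (+-assoc _ _ _))
    (+-congˡ (sym (*-identityˡ _)))))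

  ∑-vertical : ∀ l z → ∑ (λ m → outside (0F ∷ []) (ι (⟨ l , m ⟩ - z))) ≡ 2 ℕ.+ p
  ∑-vertical l z = ≡.trans (∑-cong λ m → ≡.cong (outside (0F ∷ [])) (ι-cong ([τ+ρ]-z l m z)))
    (∑-translate 1-unit (τ l - z))

  ∑-column : ∀ b i → ∑ (λ k → ∑ λ l → ∑ λ m → inColumn b i k l m) ≡ (if b then q ℕ.* (q ℕ.* (1 ℕ.+ p)) else q ℕ.* (q ℕ.* (2 ℕ.+ p)))
  ∑-column true i = ≡.trans (≡.trans
      (∑-cong λ k → ∑-cong λ l → ∑-const q (outside (0F ∷ second l ∷ []) k))
      (∑-comm λ k l → q ℕ.* outside (0F ∷ second l ∷ []) k))
    (≡.trans (∑-cong λ l → ≡.trans (≡.sym (*-distribˡ-∑ q (outside (0F ∷ second l ∷ []))))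
      (≡.cong (q ℕ.*_) (∑-second l))) (∑-const q (q ℕ.* (1 ℕ.+ p))))
  ∑-column false i = ≡.trans
    (∑-cong λ k → ≡.trans (∑-cong λ l → ∑-vertical l (τ i * ⟨ i , k ⟩)) (∑-const q (2 ℕ.+ p)))
    (∑-const q (q ℕ.* (2 ℕ.+ p)))

  module Counting (e : ℕ) (s≡d+e : 1 ℕ.+ p ≡ d ℕ.+ e) where

    -- Here `e` is q - 2 - d, so there are 2 + e columns besides the `d` special ones.
    ∑-special : ∀ a b → ∑ {q} (λ i → if special i then a else b) ≡ d ℕ.* a ℕ.+ (2 ℕ.+ e) ℕ.* b
    ∑-special a b = threshold (≡.trans (≡.cong (2 ℕ.+_) s≡d+e) (solve-∀′ d e))
      where
      solve-∀′ : ∀ d e → 2 ℕ.+ (d ℕ.+ e) ≡ d ℕ.+ (2 ℕ.+ e)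
      solve-∀′ = solve-∀

      threshold : ∀ {n} → n ≡ d ℕ.+ (2 ℕ.+ e) → ∑ {n} (λ i → if toℕ i <ᵇ d then a else b) ≡ d ℕ.* a ℕ.+ (2 ℕ.+ e) ℕ.* b
      threshold ≡.refl = ∑-threshold d (2 ℕ.+ e) a b

    ∑-inVer : ∑ inVer ≡ e
    ∑-inVer = threshold (≡.cong (2 ℕ.+_) s≡d+e)
      where
      threshold : ∀ {n} → n ≡ 2 ℕ.+ d ℕ.+ e → ∑ {n} (λ b → if toℕ b <ᵇ 2 ℕ.+ d then 0 else 1) ≡ e
      threshold ≡.refl = ≡.trans (∑-threshold (2 ℕ.+ d) e 0 1)
        (≡.cong₂ ℕ._+_ (ℕ.*-zeroʳ (2 ℕ.+ d)) (ℕ.*-identityʳ e))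

    total : sumPlaces inArc ≡ (d ℕ.* (q ℕ.* (q ℕ.* (1 ℕ.+ p))) ℕ.+ (2 ℕ.+ e) ℕ.* (q ℕ.* (q ℕ.* (2 ℕ.+ p))))
                            ℕ.+ ((d ℕ.* (q ℕ.* (1 ℕ.+ p)) ℕ.+ (2 ℕ.+ e) ℕ.* (q ℕ.* p)) ℕ.+ q ℕ.* e)
    total = ≡.cong₂ ℕ._+_
      (≡.trans (∑-cong λ i → ∑-column (special i) i) (∑-special _ _))
      (≡.cong₂ ℕ._+_
        (≡.trans (∑-cong λ i → ≡.trans (∑-const q (∑ (inGap i))) (≡.trans (≡.cong (q ℕ.*_) (∑-gap (special i) i))
            (push (special i)))) (∑-special _ _))
        (≡.trans (∑-const q (∑ inVer)) (≡.cong (q ℕ.*_) ∑-inVer)))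
      where
      push : ∀ b → q ℕ.* (if b then 1 ℕ.+ p else p) ≡ (if b then q ℕ.* (1 ℕ.+ p) else q ℕ.* p)
      push true  = ≡.refl
      push false = ≡.refl

    -- Sums over the three kinds of lines

    private
      nil≉1 : ∀ {y} → Nil y → ¬ 1# ≈ y
      nil≉1 h eq = 1-unit (nil-resp (sym eq) h)

    -- The removed points number 2 in each of the `d` special columns, 1 in every other column
    -- except possibly column `a`, and 2 or 3 at infinity. If `a` is special this gives 2d + (q - d)
    -- + 2, otherwise at least 2d + (q - d - 1) + 3; both are q + d + 2, out of q² + q points.
    slope-sum : ∀ α β → slopeSum inArc α β ℕ.+ (2 ℕ.+ d) ≤ q ℕ.* q
    slope-sum α β = begin
      _ ≡⟨ ≡.cong (ℕ._+ (2 ℕ.+ d)) (≡.cong₂ ℕ._+_ affine (≡.cong₂ ℕ._+_ infinite vertical)) ⟩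
      ∑ (λ i → ∑ λ k → inColumn (special i) i k (res (y i k)) (ι (y i k))) ℕ.+ ((if special a then 1 ℕ.+ p else p) ℕ.+ 0) ℕ.+ (2 ℕ.+ d)
        ≤⟨ ℕ.+-monoˡ-≤ (2 ℕ.+ d) (ℕ.+-monoˡ-≤ ((if special a then 1 ℕ.+ p else p) ℕ.+ 0) (∑-mono λ i → column (special i) i)) ⟩
      ∑ (λ i → (if special i then 1 ℕ.+ p else 2 ℕ.+ p) ℕ.+ restrict (i Fin.≟ a) (if special i then 0 else 1))
        ℕ.+ ((if special a then 1 ℕ.+ p else p) ℕ.+ 0) ℕ.+ (2 ℕ.+ d)
        ≡⟨ ≡.cong (λ n → n ℕ.+ ((if special a then 1 ℕ.+ p else p) ℕ.+ 0) ℕ.+ (2 ℕ.+ d))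
             (≡.trans (∑-distrib-+ (λ i → if special i then 1 ℕ.+ p else 2 ℕ.+ p) (λ i → restrict (i Fin.≟ a) (if special i then 0 else 1)))
               (≡.cong₂ ℕ._+_ (∑-special _ _) (∑-restrict (Fin._≟ a) (λ i → if special i then 0 else 1) id ≡.refl))) ⟩
      (d ℕ.* (1 ℕ.+ p) ℕ.+ (2 ℕ.+ e) ℕ.* (2 ℕ.+ p)) ℕ.+ (if special a then 0 else 1)
        ℕ.+ ((if special a then 1 ℕ.+ p else p) ℕ.+ 0) ℕ.+ (2 ℕ.+ d)
        ≡⟨ collect (d ℕ.* (1 ℕ.+ p) ℕ.+ (2 ℕ.+ e) ℕ.* (2 ℕ.+ p)) (special a) ⟩
      (d ℕ.* (1 ℕ.+ p) ℕ.+ (2 ℕ.+ e) ℕ.* (2 ℕ.+ p)) ℕ.+ (1 ℕ.+ p) ℕ.+ (2 ℕ.+ d)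
        ≡⟨ ≡.subst (λ s → (d ℕ.* s ℕ.+ (2 ℕ.+ e) ℕ.* (1 ℕ.+ s)) ℕ.+ s ℕ.+ (2 ℕ.+ d) ≡ (2 ℕ.+ s) ℕ.* (2 ℕ.+ s)) (≡.sym s≡d+e) (identity d e) ⟩
      q ℕ.* q ∎
      where
      open ℕ.≤-Reasoning

      a : Fin q
      a = res α

      y : Fin q → Fin q → Carrier
      y i k = α * ⟨ i , k ⟩ + β * 1#

      σ : Fin q → Carrier
      σ m = α * 1# + β * ρ m

      identity : ∀ d e → (d ℕ.* (d ℕ.+ e) ℕ.+ (2 ℕ.+ e) ℕ.* (1 ℕ.+ (d ℕ.+ e))) ℕ.+ (d ℕ.+ e) ℕ.+ (2 ℕ.+ d)
                   ≡ (2 ℕ.+ (d ℕ.+ e)) ℕ.* (2 ℕ.+ (d ℕ.+ e))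
      identity = solve-∀

      collect : ∀ n b → n ℕ.+ (if b then 0 else 1) ℕ.+ ((if b then 1 ℕ.+ p else p) ℕ.+ 0) ℕ.+ (2 ℕ.+ d) ≡ n ℕ.+ (1 ℕ.+ p) ℕ.+ (2 ℕ.+ d)
      collect n true  = ≡.cong (ℕ._+ (2 ℕ.+ d)) (≡.cong₂ ℕ._+_ (ℕ.+-identityʳ n) (ℕ.+-identityʳ (1 ℕ.+ p)))
      collect n false = ≡.cong (ℕ._+ (2 ℕ.+ d)) (≡.trans (ℕ.+-assoc n 1 _) (≡.cong (λ m → n ℕ.+ (1 ℕ.+ m)) (ℕ.+-identityʳ p)))

      affine : _ ≡ ∑ (λ i → ∑ λ k → inColumn (special i) i k (res (y i k)) (ι (y i k)))
      affine = ∑-cong λ i → ∑-cong λ k → ∑∑-restrict (λ l m → ⟨ l , m ⟩ ≈? y i k) (λ l m → inArc (aff i k l m))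
        ⟨⟩≈⇒ (sym (expand (y i k)))

      res-σ : ∀ m → res (σ m) ≡ a
      res-σ m = ≡.trans (res-+-nil _ (nil-*ˡ β (ρ-nil m))) (res-cong (*-identityʳ α))

      infinite : _ ≡ (if special a then 1 ℕ.+ p else p)
      -- Each `m` gives one point at infinity, always in the class of `a`, so the line crosses each
      -- removed segment of that class once.
      infinite = ≡.trans (∑-comm₃ λ i k m → restrict (⟨ i , k ⟩ ≈? σ m) (inArc (inf i k m)))
        (≡.trans (∑-cong λ m → ≡.trans (∑∑-restrict (λ i k → ⟨ i , k ⟩ ≈? σ m) (λ i k → inArc (inf i k m)) ⟨⟩≈⇒ (sym (expand (σ m))))
            (≡.cong (λ i → inGap i m) (res-σ m)))
          (∑-gap (special a) a))

      vertical : _ ≡ 0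
      vertical = ∑-zero λ b → ∑-zero λ c → restrict-no (1# ≈? α * ρ b + β * ρ c)
        (nil≉1 (nil-+ (nil-*ˡ α (ρ-nil b)) (nil-*ˡ β (ρ-nil c))))

      column : ∀ b i → ∑ (λ k → inColumn b i k (res (y i k)) (ι (y i k)))
               ≤ (if b then 1 ℕ.+ p else 2 ℕ.+ p) ℕ.+ restrict (i Fin.≟ a) (if b then 0 else 1)
      -- Within a column the residue of y is constant, so the line stays in one class and crosses
      -- both of its vertical segments.
      column true i = begin
        ∑ (λ k → outside (0F ∷ second (res (y i k)) ∷ []) k)
          ≡⟨ ∑-cong (λ k → ≡.cong (λ l → outside (0F ∷ second l ∷ []) k) (res-y k)) ⟩
        ∑ (outside (0F ∷ second (res (α * τ i + β * 1#)) ∷ []))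
          ≡⟨ ∑-second (res (α * τ i + β * 1#)) ⟩
        1 ℕ.+ p
          ≤⟨ ℕ.m≤m+n _ _ ⟩
        1 ℕ.+ p ℕ.+ restrict (i Fin.≟ a) 0 ∎
        where
        res-y : ∀ k → res (y i k) ≡ res (α * τ i + β * 1#)
        res-y k = ≡.trans (res-cong (trans (+-congʳ (distribˡ α (τ i) (ρ k))) (trans (+-assoc _ _ _)
          (trans (+-congˡ (+-comm _ _)) (sym (+-assoc _ _ _)))))) (res-+-nil _ (nil-*ˡ α (ρ-nil k)))
      column false i with i Fin.≟ a
      -- The line is parallel to the removed segments and may miss them, so only the trivial bound
      -- is available.
      ... | yes _ = begin
        ∑ (λ k → inColumn false i k (res (y i k)) (ι (y i k)))
          ≤⟨ ∑-mono (λ k → outside≤1 (0F ∷ []) (ι (⟨ res (y i k) , ι (y i k) ⟩ - τ i * ⟨ i , k ⟩))) ⟩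
        ∑ {q} (λ _ → 1) ≡⟨ ∑-const q 1 ⟩
        q ℕ.* 1 ≡⟨ ℕ.*-identityʳ q ⟩
        q ≡⟨ ℕ.+-comm 1 (2 ℕ.+ p) ⟩
        2 ℕ.+ p ℕ.+ 1 ∎
      -- Now α - τ i is a unit, and `∑-translate` counts one crossing.
      ... | no i≢a = begin
        ∑ (λ k → outside (0F ∷ []) (ι (⟨ res (y i k) , ι (y i k) ⟩ - τ i * ⟨ i , k ⟩)))
          ≡⟨ ∑-cong (λ k → ≡.cong (outside (0F ∷ [])) (ι-cong (shift k))) ⟩
        ∑ (λ k → outside (0F ∷ []) (ι (((α - τ i) * τ i + β * 1#) + (α - τ i) * ρ k)))
          ≡⟨ ∑-translate (λ h → i≢a (≡.sym (≡.trans (nil⇒res h) (res-τ i)))) _ ⟩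
        2 ℕ.+ p
          ≤⟨ ℕ.m≤m+n _ _ ⟩
        2 ℕ.+ p ℕ.+ 0 ∎
        where
        shift : ∀ k → ⟨ res (y i k) , ι (y i k) ⟩ - τ i * ⟨ i , k ⟩ ≈ ((α - τ i) * τ i + β * 1#) + (α - τ i) * ρ k
        shift k = trans (+-congʳ (sym (expand (y i k)))) (trans (+-assoc _ _ _) (trans (+-congˡ (+-comm _ _))
          (trans (sym (+-assoc _ _ _)) (trans (+-congʳ (sym ([y-z]x≈yx-zx ⟨ i , k ⟩ α (τ i))))
            (trans (+-congʳ (distribˡ (α - τ i) (τ i) (ρ k))) (trans (+-assoc _ _ _) (trans (+-congˡ (+-comm _ _))
              (sym (+-assoc _ _ _)))))))))

    -- The line lies in column `i₀` and the vertical class at infinity, where `e` of its points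
    -- survive. As q² - 2 - d equals q (q - 1) + e, the column has to remove `q` points: one in each
    -- class `l` if it is not special, a whole segment otherwise.
    steep-sum : ∀ α β → Nil α → steepSum inArc α β ℕ.+ (2 ℕ.+ d) ≤ q ℕ.* q
    steep-sum α β α-nil = begin
      _ ≡⟨ ≡.cong (ℕ._+ (2 ℕ.+ d)) (≡.cong₂ ℕ._+_ affine (≡.cong₂ ℕ._+_ infinite vertical)) ⟩
      ∑ (λ l → ∑ λ m → inColumn (special i₀) i₀ (ι (x l)) l m) ℕ.+ (0 ℕ.+ e) ℕ.+ (2 ℕ.+ d)
        ≤⟨ ℕ.+-monoˡ-≤ (2 ℕ.+ d) (ℕ.+-monoˡ-≤ e (column (special i₀))) ⟩
      q ℕ.* (2 ℕ.+ p) ℕ.+ e ℕ.+ (2 ℕ.+ d)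
        ≡⟨ ≡.subst (λ s → (2 ℕ.+ s) ℕ.* (1 ℕ.+ s) ℕ.+ e ℕ.+ (2 ℕ.+ d) ≡ (2 ℕ.+ s) ℕ.* (2 ℕ.+ s)) (≡.sym s≡d+e) (identity d e) ⟩
      q ℕ.* q ∎
      where
      open ℕ.≤-Reasoning

      i₀ : Fin q
      i₀ = res (β * 1#)

      x : Fin q → Carrier
      x l = α * τ l + β * 1#

      identity : ∀ d e → (2 ℕ.+ (d ℕ.+ e)) ℕ.* (1 ℕ.+ (d ℕ.+ e)) ℕ.+ e ℕ.+ (2 ℕ.+ d) ≡ (2 ℕ.+ (d ℕ.+ e)) ℕ.* (2 ℕ.+ (d ℕ.+ e))
      identity = solve-∀

      res-x : ∀ l → res (x l) ≡ i₀
      res-x l = ≡.trans (res-cong (+-comm _ _)) (res-+-nil (β * 1#) (nil-*ʳ (τ l) α-nil))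

      affine : _ ≡ ∑ (λ l → ∑ λ m → inColumn (special i₀) i₀ (ι (x l)) l m)
      affine = ≡.trans
        (∑-comm₄ λ i k l m → restrict (⟨ i , k ⟩ ≈? α * ⟨ l , m ⟩ + β * 1#) (inArc (aff i k l m)))
        (∑-cong λ l → ∑-cong λ m → ≡.trans
          (∑∑-restrict (λ i k → ⟨ i , k ⟩ ≈? α * ⟨ l , m ⟩ + β * 1#) (λ i k → inArc (aff i k l m)) {res (x l)} {ι (x l)}
            (λ eq → ⟨⟩≈⇒ (trans eq (+-congʳ (nil*⟨⟩ α-nil l m))))
            (trans (sym (expand (x l))) (+-congʳ (sym (nil*⟨⟩ α-nil l m)))))
          (≡.cong (λ i → inColumn (special i) i (ι (x l)) l m) (res-x l)))

      infinite : _ ≡ 0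
      infinite = ∑-zero λ i → ∑-zero λ k → ∑-zero λ m → restrict-no (1# ≈? α * ⟨ i , k ⟩ + β * ρ m)
        (nil≉1 (nil-+ (nil-*ʳ ⟨ i , k ⟩ α-nil) (nil-*ˡ β (ρ-nil m))))

      vertical : _ ≡ e
      vertical = ≡.trans (∑-comm λ a b → restrict (ρ a ≈? α * 1# + β * ρ b) (inVer b))
        (≡.trans (∑-cong λ b → ∑-restrict (λ a → ρ a ≈? α * 1# + β * ρ b) (λ _ → inVer b) ρ≈⇒
            (sym (nil-expand (nil-+ (nil-*ʳ 1# α-nil) (nil-*ˡ β (ρ-nil b))))))
          ∑-inVer)

      -- If α ≉ 0, then ατ l runs through the radical and the digit of `x l` is 0 for some `l`,
      -- which hits a first segment. If α ≈ 0, the digit is a constant `b`, which in class l = b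
      -- belongs to the first segment (b = 0) or the second.
      avoided : ∃[ l ] outside (0F ∷ second l ∷ []) (ι (x l)) ≡ 0
      avoided with α ≈? 0#
      ... | yes α≈0 = ι (β * 1#) , ≡.trans (≡.cong (outside (0F ∷ second (ι (β * 1#)) ∷ [])) (ι-cong x≈β))
              (outside-∈ (b∈ (ι (β * 1#))))
        where
        x≈β : x (ι (β * 1#)) ≈ β * 1#
        x≈β = trans (+-congʳ (trans (*-congʳ α≈0) (zeroˡ _))) (+-identityˡ _)

        b∈ : ∀ b → b ∈ˡ 0F ∷ second b ∷ []
        b∈ 0F      = here ≡.refl
        b∈ (suc b) = there (here ≡.refl)
      ... | no α≉0 with divideτ α-nil α≉0 (res⇒nil {τ i₀} {β * 1#} (res-τ i₀))
      ...   | l , ατ≈ = l , outside-∈ {xs = 0F ∷ second l ∷ []} (here (≡.trans (ι-cong x≈) (ι-⟨⟩ i₀ 0F)))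
        where
        x≈ : x l ≈ ⟨ i₀ , 0F ⟩
        x≈ = trans (+-comm _ _) (trans (+-congˡ ατ≈) (trans (sym (x≈y+[x-y] (τ i₀) (β * 1#)))
          (trans (sym (+-identityʳ _)) (+-congˡ (sym ρ-zero)))))

      column : ∀ b → ∑ (λ l → ∑ λ m → inColumn b i₀ (ι (x l)) l m) ≤ q ℕ.* (2 ℕ.+ p)
      column true = ℕ.+-cancelʳ-≤ (q ℕ.* 1) _ _ (begin
        ∑ (λ l → ∑ {q} λ m → outside (0F ∷ second l ∷ []) (ι (x l))) ℕ.+ q ℕ.* 1
          ≡⟨ ≡.cong (ℕ._+ q ℕ.* 1) (∑-cong λ l → ∑-const q (outside (0F ∷ second l ∷ []) (ι (x l)))) ⟩
        ∑ (λ l → q ℕ.* outside (0F ∷ second l ∷ []) (ι (x l))) ℕ.+ q ℕ.* 1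
          ≤⟨ ∑-vanishing q (λ l → ℕ.≤-trans (ℕ.*-monoʳ-≤ q (outside≤1 (0F ∷ second l ∷ []) (ι (x l)))) (ℕ.≤-reflexive (ℕ.*-identityʳ q)))
               {proj₁ avoided ∷ []} ([] ∷ []) (≡.trans (≡.cong (q ℕ.*_) (proj₂ avoided)) (ℕ.*-zeroʳ q) ∷ []) ⟩
        q ℕ.* q
          ≡⟨ ≡.cong (q ℕ.*_) (ℕ.+-comm 1 (2 ℕ.+ p)) ⟩
        q ℕ.* (2 ℕ.+ p ℕ.+ 1)
          ≡⟨ ℕ.*-distribˡ-+ q (2 ℕ.+ p) 1 ⟩
        q ℕ.* (2 ℕ.+ p) ℕ.+ q ℕ.* 1 ∎)
      column false = ℕ.≤-reflexive (≡.trans (∑-cong λ l → ∑-vertical l (τ i₀ * ⟨ i₀ , ι (x l) ⟩)) (∑-const q (2 ℕ.+ p)))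

    module _ {A B : Carrier} (A-nil : Nil A) (B-nil : Nil B) where

      private
        -- A line z = Ax + By with nil coefficients is a union of q + 1 whole segments, one in each
        -- class at infinity. In the class of slope `τ i` it is the segment at height A + Bτ i, and
        -- `f i` tells whether that segment is kept.
        f : Fin q → ℕ
        f i = inGap i (ι (A + B * τ i))

        ∈gap⇒f≡0 : ∀ i {b} → b ∈ˡ gap (special i) i → A + B * τ i ≈ ρ b * multiplier i → f i ≡ 0
        ∈gap⇒f≡0 i {b} b∈ eq = outside-∈ (≡.subst (_∈ˡ map (twist i) (gap (special i) i)) (≡.sym index)
          (∈-map⁺ (twist i) b∈))
          where
          index : ι (A + B * τ i) ≡ twist i b
          index = ≡.trans (ι-cong (trans eq (trans (*-assoc π (τ b) (multiplier i))
            (*-nil-cong π-nil (≡.sym (res-τ _)))))) (ι-ρ (twist i b))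

        0∈gap : ∀ b i → 0F ∈ˡ gap b i
        0∈gap true  i = here ≡.refl
        0∈gap false i = here ≡.refl

        1∈gap : ∀ b i → 1F ∈ˡ gap b i
        1∈gap true  i = there (here ≡.refl)
        1∈gap false i = there (here ≡.refl)

        vanish : ∀ i → A + B * τ i ≈ 0# → f i ≡ 0
        vanish i eq = ∈gap⇒f≡0 i (0∈gap (special i) i)
          (trans eq (sym (trans (*-congʳ ρ-zero) (zeroˡ _))))

        x≈-y⇒y+x≈0 : ∀ {x y} → x ≈ - y → y + x ≈ 0#
        x≈-y⇒y+x≈0 {x} {y} eq = trans (+-congˡ eq) (-‿inverseʳ y)

        vanish-solution : ¬ B ≈ 0# → ∃[ i ] A + B * τ i ≈ 0#
        vanish-solution B≉0 =
          let i , eq = divideτ B-nil B≉0 (nil-neg A-nil) in i , x≈-y⇒y+x≈0 eq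

        ρ1≉0 : ¬ ρ 1F ≈ 0#
        ρ1≉0 eq with ρ-injective (trans eq (sym ρ-zero))
        ... | ()

        A+0≈A : ∀ {x} → x ≈ 0# → A + x ≈ A
        A+0≈A h = trans (+-congˡ h) (+-identityʳ A)

        *τ0≈0 : ∀ x → x * τ 0F ≈ 0#
        *τ0≈0 x = trans (*-congˡ τ-zero) (zeroʳ x)

        -- For i = 0 the equation would read A ≈ 0, so the exceptional multiplier does no harm.
        ρ1-hit : ¬ A ≈ 0# → ∀ i → A + B * τ i ≈ ρ 1F * τ i → f i ≡ 0
        ρ1-hit A≉0 0F      eq = contradiction (trans (sym (A+0≈A (*τ0≈0 B))) (trans eq (*τ0≈0 (ρ 1F)))) A≉0
        ρ1-hit A≉0 (suc i) eq = ∈gap⇒f≡0 (suc i) (1∈gap (special (suc i)) (suc i)) eq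

        -- If B ≉ 0, solve A + Bτ i ≈ 0. If B ≈ 0, the height is constantly `A`: it is 0 everywhere,
        -- or it equals ρ 1 τ i for some `i`.
        oneHit : Dec (B ≈ 0#) → Dec (A ≈ 0#) → ∃[ i ] f i ≡ 0
        oneHit (no B≉0) _ = let i , eq = vanish-solution B≉0 in i , vanish i eq
        oneHit (yes B≈0) (yes A≈0) = 0F , vanish 0F (trans (A+0≈A (*τ0≈0 B)) A≈0)
        oneHit (yes B≈0) (no A≉0) = let i , eq = divideτ (ρ-nil 1F) ρ1≉0 A-nil in
          i , ρ1-hit A≉0 i (trans (A+0≈A (trans (*-congʳ B≈0) (zeroˡ _))) (sym eq))

        special-false : ∀ j → (toℕ j <ᵇ 2 ℕ.+ d) ≡ false → special j ≡ false
        special-false j eq with toℕ j <ᵇ d in eq′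
        ... | false = ≡.refl
        ... | true with ≡.trans (≡.sym eq) (dec-true (ℕ.≤-trans (ℕ.<ᵇ⇒< (toℕ j) d (≡.subst T (≡.sym eq′) tt)) (ℕ.m≤n+m d 2)))
          where
          dec-true : ∀ {m n} → m ℕ.< n → (m <ᵇ n) ≡ true
          dec-true {m} {n} m<n with m <ᵇ n | ℕ.<⇒<ᵇ m<n
          ... | true | _ = ≡.refl
        ...   | ()

        ιB≢⇒B≉ρ : ∀ {b k} → ι B ≡ b → b ≢ k → ¬ B ≈ ρ k
        ιB≢⇒B≉ρ {k = k} ιB≡ b≢k B≈ρk = b≢k (≡.trans (≡.sym ιB≡) (≡.trans (ι-cong B≈ρk) (ι-ρ k)))

        -- Now `B` is neither 0 nor ρ 1. If A ≈ 0, the class 0 has height 0 and the class `b`, which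
        -- is not special, has height ρ b τ b, its third removed segment. If A ≉ 0, the equations A
        -- + Bτ i ≈ 0 and A + Bτ j ≈ ρ 1 τ j are solvable; a common solution would have τ i ≈ 0 and
        -- hence A ≈ 0.
        twoHits : ∀ b → ι B ≡ b → (toℕ b <ᵇ 2 ℕ.+ d) ≡ false → Dec (A ≈ 0#) →
                  ∃[ i ] ∃[ j ] i ≢ j × f i ≡ 0 × f j ≡ 0
        twoHits 0F _ ()
        twoHits 1F _ ()
        twoHits b@(suc (suc b-2)) ιB≡ outer (yes A≈0) = 0F , b , (λ ())
          , vanish 0F (trans (A+0≈A (*τ0≈0 B)) A≈0)
          , ∈gap⇒f≡0 b (≡.subst (λ s → b ∈ˡ gap s b) (≡.sym (special-false b outer)) (there (there (here ≡.refl))))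
              (trans (+-congʳ A≈0) (trans (+-identityˡ _)
                (*-congʳ (trans (nil-expand B-nil) (reflexive (≡.cong ρ ιB≡))))))
        twoHits b@(suc (suc b-2)) ιB≡ outer (no A≉0) =
          let i , Bτi≈ = vanish-solution (λ B≈0 → ιB≢⇒B≉ρ ιB≡ (λ ()) (trans B≈0 (sym ρ-zero)))
              j , eq   = divideτ (nil-+ B-nil (nil-neg (ρ-nil 1F)))
                           (λ eq → ιB≢⇒B≉ρ ιB≡ (λ ()) (x∙y⁻¹≈ε⇒x≈y _ _ eq)) (nil-neg A-nil)
          in i , j , i≢j i j Bτi≈ (A+Bτj≈ j eq) , vanish i Bτi≈ , ρ1-hit A≉0 j (A+Bτj≈ j eq)
          where
          A+Bτj≈ : ∀ j → (B - ρ 1F) * τ j ≈ - A → A + B * τ j ≈ ρ 1F * τ j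
          A+Bτj≈ j eq = trans (+-congˡ (trans (x≈y+[x-y] _ (ρ 1F * τ j))
              (+-congˡ (trans (sym ([y-z]x≈yx-zx (τ j) B (ρ 1F))) eq))))
            (trans (+-congˡ (+-comm _ _)) (trans (sym (+-assoc _ _ _))
              (trans (+-congʳ (-‿inverseʳ A)) (+-identityˡ _))))

          i≢j : ∀ i j → A + B * τ i ≈ 0# → A + B * τ j ≈ ρ 1F * τ j → i ≢ j
          i≢j i .i hi hj ≡.refl = A≉0 (trans (sym (A+0≈A (trans (*-congˡ τi≈0) (zeroʳ B)))) hi)
            where
            τi≈0 : τ i ≈ 0#
            τi≈0 = trans (reflexive (≡.cong τ (≡.trans (≡.sym (res-τ i))
              (annihilator-nil ρ1≉0 (trans (sym hj) hi))))) τ-zero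

      -- At least two of the q + 1 segments are removed. If the vertical class already supplies one,
      -- `oneHit` gives the other; otherwise `twoHits` gives both.
      far-hits : ∑ f ℕ.+ inVer (ι B) ≤ 2 ℕ.+ p
      far-hits with toℕ (ι B) <ᵇ 2 ℕ.+ d in eq
      ... | true with oneHit (B ≈? 0#) (A ≈? 0#)
      ...   | i , fi≡0 = ℕ.+-cancelʳ-≤ 1 _ _ (begin
        ∑ f ℕ.+ 0 ℕ.+ 1            ≡⟨ ≡.cong (ℕ._+ 1) (ℕ.+-identityʳ (∑ f)) ⟩
        ∑ f ℕ.+ 1                  ≤⟨ ∑-vanishing 1 f≤1 {i ∷ []} ([] ∷ []) (fi≡0 ∷ []) ⟩
        1 ℕ.* q                    ≡⟨ ≡.trans (ℕ.*-identityˡ q) (ℕ.+-comm 1 (2 ℕ.+ p)) ⟩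
        2 ℕ.+ p ℕ.+ 1              ∎)
        where
        open ℕ.≤-Reasoning
        f≤1 : ∀ i → f i ≤ 1
        f≤1 i = outside≤1 (map (twist i) (gap (special i) i)) (ι (A + B * τ i))
      far-hits | false with twoHits (ι B) ≡.refl eq (A ≈? 0#)
      ... | i , j , i≢j , fi≡0 , fj≡0 = ℕ.+-cancelʳ-≤ 1 _ _ (begin
        ∑ f ℕ.+ 1 ℕ.+ 1            ≡⟨ ℕ.+-assoc (∑ f) 1 1 ⟩
        ∑ f ℕ.+ 2                  ≤⟨ ∑-vanishing 1 f≤1 {i ∷ j ∷ []} ((i≢j ∷ []) ∷ [] ∷ []) (fi≡0 ∷ fj≡0 ∷ []) ⟩
        1 ℕ.* q                    ≡⟨ ≡.trans (ℕ.*-identityˡ q) (ℕ.+-comm 1 (2 ℕ.+ p)) ⟩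
        2 ℕ.+ p ℕ.+ 1              ∎)
        where
        open ℕ.≤-Reasoning
        f≤1 : ∀ i → f i ≤ 1
        f≤1 i = outside≤1 (map (twist i) (gap (special i) i)) (ι (A + B * τ i))

    -- At most q - 1 segments of `q` points each are kept, and q (q - 1) is at most q² - 2 - d
    -- because 2 + d ≤ q.
    far-sum : ∀ α β → Nil α → Nil β →
              farSum inArc α β ℕ.+ (2 ℕ.+ d) ≤ q ℕ.* q
    far-sum α β α-nil β-nil = begin
      _ ≡⟨ ≡.cong (ℕ._+ (2 ℕ.+ d)) (≡.cong₂ ℕ._+_ affine (≡.cong₂ ℕ._+_ infinite vertical)) ⟩
      q ℕ.* ∑ f ℕ.+ q ℕ.* inVer (ι β) ℕ.+ (2 ℕ.+ d)
        ≡⟨ ≡.cong (ℕ._+ (2 ℕ.+ d)) (≡.sym (ℕ.*-distribˡ-+ q (∑ f) (inVer (ι β)))) ⟩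
      q ℕ.* (∑ f ℕ.+ inVer (ι β)) ℕ.+ (2 ℕ.+ d)
        ≤⟨ ℕ.+-mono-≤ (ℕ.*-monoʳ-≤ q (far-hits α-nil β-nil)) 2+d≤q ⟩
      q ℕ.* (2 ℕ.+ p) ℕ.+ q
        ≡⟨ ≡.trans (ℕ.+-comm _ q) (≡.sym (ℕ.*-suc q (2 ℕ.+ p))) ⟩
      q ℕ.* q ∎
      where
      open ℕ.≤-Reasoning

      f : Fin q → ℕ
      f i = inGap i (ι (α + β * τ i))

      2+d≤q : 2 ℕ.+ d ≤ q
      2+d≤q = s≤s (s≤s (≡.subst (d ≤_) (≡.sym s≡d+e) (ℕ.m≤m+n d e)))

      affine : _ ≡ 0
      affine = ∑-zero λ i → ∑-zero λ k → ∑-zero λ l → ∑-zero λ m →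
        restrict-no (1# ≈? α * ⟨ i , k ⟩ + β * ⟨ l , m ⟩) (nil≉1 (nil-+ (nil-*ʳ ⟨ i , k ⟩ α-nil) (nil-*ʳ ⟨ l , m ⟩ β-nil)))

      infinite : _ ≡ q ℕ.* ∑ f
      infinite = ≡.trans (∑-cong λ i → ≡.trans (∑-cong λ k →
          ∑-restrict (λ m → ρ m ≈? α * 1# + β * ⟨ i , k ⟩) (inGap i) {ι (α + β * τ i)}
            (λ eq → ρ≈⇒ (trans eq (simplify i k)))
            (trans (sym (nil-expand (nil-+ α-nil (nil-*ʳ (τ i) β-nil)))) (sym (simplify i k))))
          (∑-const q (f i)))
        (≡.sym (*-distribˡ-∑ q f))
        where
        simplify : ∀ i k → α * 1# + β * ⟨ i , k ⟩ ≈ α + β * τ i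
        simplify i k = +-cong (*-identityʳ α) (nil*⟨⟩ β-nil i k)

      vertical : _ ≡ q ℕ.* inVer (ι β)
      vertical = ≡.trans (∑-cong λ a → ∑-restrict (λ b → ρ b ≈? α * ρ a + β * 1#) inVer {ι β}
          (λ eq → ρ≈⇒ (trans eq (simplify a)))
          (trans (sym (nil-expand β-nil)) (sym (simplify a))))
        (∑-const q (inVer (ι β)))
        where
        simplify : ∀ a → α * ρ a + β * 1# ≈ β
        simplify a = trans (+-cong (nil-* α-nil (ρ-nil a)) (*-identityʳ β)) (+-identityˡ β)

-- Parameters and the lower bound

open import Algebra.Apartness.Bundles using (HeytingField; HeytingCommutativeRing)
open import Data.Nat using (_+_; _*_; _∸_; _^_)
open import Data.Integer as ℤ using (+_)
import Data.Integer.Properties as ℤ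
import Data.Integer.Tactic.RingSolver as ℤSolver

-- Both sides carry q² (2 + d), as n = q² - 2 - d, to avoid subtraction. Distinguishing d = 0 allows
-- 1 + p ≡ d + e to be solved for `e` or for `p` within the natural numbers.
arcSize-identity : ∀ d e p → 1 + p ≡ d + e → let q = 3 + p in
  (d * (q * (q * (1 + p))) + (2 + e) * (q * (q * (2 + p)))) + ((d * (q * (1 + p)) + (2 + e) * (q * p)) + q * e)
  + 2 * q + (e * q + q * q * (2 + d)) ≡ (q * q) * (q * q) + e * q
arcSize-identity ℕ.zero e p ≡.refl = identity p
  where
  identity : ∀ p → let q = 3 + p; e = 1 + p in
    ((2 + e) * (q * (q * (2 + p)))) + (((2 + e) * (q * p)) + q * e) + 2 * q + (e * q + q * q * 2) ≡ (q * q) * (q * q) + e * q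
  identity = solve-∀
arcSize-identity (ℕ.suc d) e .(d + e) ≡.refl = identity d e
  where
  identity : ∀ d e → let q = 3 + (d + e) in
    ((1 + d) * (q * (q * (1 + (d + e)))) + (2 + e) * (q * (q * (2 + (d + e))))) + (((1 + d) * (q * (1 + (d + e))) + (2 + e) * (q * (d + e))) + q * e)
    + 2 * q + (e * q + q * q * (3 + d)) ≡ (q * q) * (q * q) + e * q
  identity = solve-∀

q^2≡q*q : ∀ q → q ^ 2 ≡ q * q
q^2≡q*q q = ≡.cong (q *_) (ℕ.*-identityʳ q)

-- Since qn = q³ - q² + qt, the bound is the integer q²n - 2q in another form.
lowerBound : ∀ q n t k → n + q ≡ q * q + t → q ^ 2 * n ∸ 2 * q ≤ k →
  + q ℤ.* (+ q ℤ.+ + 1) ℤ.* + n ℤ.- (+ q) ℤ.^ 3 ℤ.+ + q ℤ.* (+ q ℤ.- + 2 ℤ.- + t) ℤ.≤ + k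
lowerBound q n t k n+q≡ size≤k = begin
  + q ℤ.* (+ q ℤ.+ + 1) ℤ.* + n ℤ.- (+ q) ℤ.^ 3 ℤ.+ + q ℤ.* (+ q ℤ.- + 2 ℤ.- + t)
    ≡⟨ ≡.cong (λ N → + q ℤ.* (+ q ℤ.+ + 1) ℤ.* N ℤ.- (+ q) ℤ.^ 3 ℤ.+ + q ℤ.* (+ q ℤ.- + 2 ℤ.- + t)) +n≡ ⟩
  + q ℤ.* (+ q ℤ.+ + 1) ℤ.* (+ q ℤ.* + q ℤ.+ + t ℤ.- + q) ℤ.- (+ q) ℤ.^ 3 ℤ.+ + q ℤ.* (+ q ℤ.- + 2 ℤ.- + t)
    ≡⟨ identity (+ q) (+ t) ⟩
  + q ℤ.* + q ℤ.* (+ q ℤ.* + q ℤ.+ + t ℤ.- + q) ℤ.- + 2 ℤ.* + q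
    ≡⟨ ≡.cong (λ N → + q ℤ.* + q ℤ.* N ℤ.- + 2 ℤ.* + q) +n≡ ⟨
  + q ℤ.* + q ℤ.* + n ℤ.- + 2 ℤ.* + q
    ≡⟨ ≡.cong₂ ℤ._-_ (≡.trans (ℤ.pos-* (q ^ 2) n) (≡.cong (ℤ._* + n) (≡.trans (≡.cong +_ (q^2≡q*q q)) (ℤ.pos-* q q)))) (ℤ.pos-* 2 q) ⟨
  + (q ^ 2 * n) ℤ.- + (2 * q)
    ≡⟨ ℤ.m-n≡m⊖n (q ^ 2 * n) (2 * q) ⟩
  q ^ 2 * n ℤ.⊖ (2 * q)
    ≤⟨ ⊖≤∸ (q ^ 2 * n) (2 * q) ⟩
  + (q ^ 2 * n ∸ 2 * q)
    ≤⟨ ℤ.+≤+ size≤k ⟩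
  + k ∎
  where
  open ℤ.≤-Reasoning

  ⊖≤∸ : ∀ a b → a ℤ.⊖ b ℤ.≤ + (a ∸ b)
  ⊖≤∸ a b = ℤ.≤-trans (ℤ.⊖-monoˡ-≤ b (ℕ.m≤n+m∸n a b))
    (ℤ.≤-reflexive (≡.trans (ℤ.⊖-≥ (ℕ.m≤m+n b (a ∸ b))) (≡.cong +_ (ℕ.m+n∸m≡n b (a ∸ b)))))

  +n≡ : + n ≡ + q ℤ.* + q ℤ.+ + t ℤ.- + q
  +n≡ = ≡.trans (cancel (+ n) (+ q)) (≡.cong (ℤ._- + q)
    (≡.trans (≡.sym (ℤ.pos-+ n q)) (≡.trans (≡.cong +_ n+q≡) (≡.trans (ℤ.pos-+ (q * q) t) (≡.cong (ℤ._+ + t) (ℤ.pos-* q q))))))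
    where
    cancel : ∀ N Q → N ≡ N ℤ.+ Q ℤ.- Q
    cancel = ℤSolver.solve-∀

  identity : ∀ Q T → Q ℤ.* (Q ℤ.+ + 1) ℤ.* (Q ℤ.* Q ℤ.+ T ℤ.- Q) ℤ.- Q ℤ.* (Q ℤ.* (Q ℤ.* + 1)) ℤ.+ Q ℤ.* (Q ℤ.- + 2 ℤ.- T)
             ≡ Q ℤ.* Q ℤ.* (Q ℤ.* Q ℤ.+ T ℤ.- Q) ℤ.- + 2 ℤ.* Q
  identity = ℤSolver.solve-∀

projectiveArcExists : ∀ {c ℓ} (R : Ring c ℓ) {p} → Coordinates R p → let q = ℕ.suc p in
  ∀ n → q ^ 2 ∸ q ≤ n → n ≤ q ^ 2 ∸ 2 → PHG.HasProjectiveArc R (q ^ 2 * n ∸ 2 * q) n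
-- With a single residue class, 1 would be nil.
projectiveArcExists R {0} C n lo hi = contradiction (zero-unique _) (Coordinates.1-unit C)
  where
  zero-unique : ∀ (i : Fin 1) → i ≡ zero
  zero-unique zero = ≡.refl
-- For q = 2 both bounds on `n` equal 2, and q²n - 2q = 4 is the size of a neighbour class.
projectiveArcExists R {1} C n lo hi with ℕ.≤-antisym hi lo
... | ≡.refl = PointClass.pointClassArc R C
projectiveArcExists R {ℕ.suc (ℕ.suc p)} C n lo hi = projectiveArc inArc inArc-01
  (≡.trans (total e s≡d+e) size≡)
  (λ α β → cancel (slope-sum e s≡d+e α β))
  (λ α β hα → cancel (steep-sum e s≡d+e α β hα))
  (λ α β hα hβ → cancel (far-sum e s≡d+e α β hα hβ))
  where
  q d e : ℕ
  q = 3 + p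
  -- The upper bound on `n` makes this an exact difference; the lower one gives d ≤ q - 2, so that
  -- `e` is exact as well.
  d = q ^ 2 ∸ 2 ∸ n
  e = 1 + p ∸ d

  open ArcCriterion R C
  open Arc R C d
  open Counting

  n+2+d≡q² : n + (2 + d) ≡ q * q
  n+2+d≡q² = begin
    n + (2 + d)       ≡⟨ ℕ.+-assoc n 2 d ⟨
    n + 2 + d         ≡⟨ ≡.cong (_+ d) (ℕ.+-comm n 2) ⟩
    2 + (n + d)       ≡⟨ ≡.cong (λ m → 2 + m) (ℕ.m+[n∸m]≡n hi) ⟩
    q ^ 2             ≡⟨ q^2≡q*q q ⟩
    q * q             ∎
    where open ≡.≡-Reasoning

  2+d≤q : 2 + d ≤ q
  2+d≤q = ℕ.+-cancelˡ-≤ n _ _ (begin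
    n + (2 + d)       ≡⟨ n+2+d≡q² ⟩
    q * q             ≡⟨ q^2≡q*q q ⟨
    q ^ 2             ≤⟨ ℕ.m≤n+m∸n (q ^ 2) q ⟩
    q + (q ^ 2 ∸ q)   ≤⟨ ℕ.+-monoʳ-≤ q lo ⟩
    q + n             ≡⟨ ℕ.+-comm q n ⟩
    n + q             ∎)
    where open ℕ.≤-Reasoning

  s≡d+e : 1 + p ≡ d + e
  s≡d+e = ≡.sym (ℕ.m+[n∸m]≡n (ℕ.s≤s⁻¹ (ℕ.s≤s⁻¹ 2+d≤q)))

  cancel : ∀ {s} → s + (2 + d) ≤ q * q → s ≤ n
  cancel {s} h = ℕ.+-cancelʳ-≤ (2 + d) s n (ℕ.≤-trans h (ℕ.≤-reflexive (≡.sym n+2+d≡q²)))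

  size : ℕ
  size = (d * (q * (q * (1 + p))) + (2 + e) * (q * (q * (2 + p)))) + ((d * (q * (1 + p)) + (2 + e) * (q * p)) + q * e)

  size+2q≡q²n : size + 2 * q ≡ q ^ 2 * n
  size+2q≡q²n = ℕ.+-cancelʳ-≡ (e * q + q * q * (2 + d)) _ _ (begin
    size + 2 * q + (e * q + q * q * (2 + d))        ≡⟨ arcSize-identity d e p s≡d+e ⟩
    q * q * (q * q) + e * q                         ≡⟨ ≡.cong (λ m → q * q * m + e * q) n+2+d≡q² ⟨
    q * q * (n + (2 + d)) + e * q                   ≡⟨ ≡.cong (_+ e * q) (ℕ.*-distribˡ-+ (q * q) n (2 + d)) ⟩
    q * q * n + q * q * (2 + d) + e * q             ≡⟨ ℕ.+-assoc (q * q * n) _ _ ⟩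
    q * q * n + (q * q * (2 + d) + e * q)           ≡⟨ ≡.cong₂ _+_ (≡.cong (_* n) (≡.sym (q^2≡q*q q))) (ℕ.+-comm (q * q * (2 + d)) (e * q)) ⟩
    q ^ 2 * n + (e * q + q * q * (2 + d))           ∎)
    where open ≡.≡-Reasoning

  size≡ : size ≡ q ^ 2 * n ∸ 2 * q
  size≡ = ≡.trans (≡.sym (ℕ.m+n∸n≡m size (2 * q))) (≡.cong (_∸ 2 * q) size+2q≡q²n)

theorem3p2 : ∀ {c ℓ a ℓ₁ ℓ₂} (R : Ring c ℓ) → IsFiniteChainRingOfLength2 R →
    ∀ (q : ℕ) (F : HeytingField a ℓ₁ ℓ₂) →
    let 𝔽q = HeytingCommutativeRing.commutativeRing (HeytingField.heytingCommutativeRing F) in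
    HasSize (CommutativeRing.setoid 𝔽q) q →
    ∃ (RingMorphisms.IsRingIsomorphism (R/rad R) (CommutativeRing.rawRing 𝔽q)) →
    ∀ (n : ℕ) → q ^ 2 ∸ q ≤ n → n ≤ q ^ 2 ∸ 2 →
    PHG.HasProjectiveArc R (q ^ 2 * n ∸ 2 * q) n
    ×
    (∀ (t : ℕ) → t ≤ q ∸ 2 → n ≡ q ^ 2 ∸ q + t →
    ∀ (m : ℕ) → PHG.IsMaxArcSize R n m →
    + q ℤ.* (+ q ℤ.+ + 1) ℤ.* + n ℤ.- (+ q) ℤ.^ 3
    ℤ.+ + q ℤ.* (+ q ℤ.- + 2 ℤ.- + t) ℤ.≤ + m)
theorem3p2 R chain ℕ.zero F size iso n lo hi with Inverse.to size (HeytingField.0# F)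
... | ()
theorem3p2 R chain (ℕ.suc p) F size iso n lo hi = arc , λ t _ n≡ m max →
  lowerBound q n t m (n+q≡ t n≡) (proj₂ max _ arc)
  where
  q : ℕ
  q = ℕ.suc p

  𝔽q = HeytingCommutativeRing.commutativeRing (HeytingField.heytingCommutativeRing F)

  arc : PHG.HasProjectiveArc R (q ^ 2 * n ∸ 2 * q) n
  arc = projectiveArcExists R (coordinates R chain 𝔽q size iso) n lo hi

  q≤q² : q ≤ q * q
  q≤q² = ℕ.m≤m*n q q

  n+q≡ : ∀ t → n ≡ q ^ 2 ∸ q + t → n + q ≡ q * q + t
  n+q≡ t ≡.refl = begin
    q ^ 2 ∸ q + t + q     ≡⟨ ℕ.+-assoc (q ^ 2 ∸ q) t q ⟩
    q ^ 2 ∸ q + (t + q)   ≡⟨ ≡.cong₂ _+_ (≡.cong (_∸ q) (q^2≡q*q q)) (ℕ.+-comm t q) ⟩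
    q * q ∸ q + (q + t)   ≡⟨ ℕ.+-assoc (q * q ∸ q) q t ⟨
    q * q ∸ q + q + t     ≡⟨ ≡.cong (_+ t) (ℕ.m∸n+n≡m q≤q²) ⟩
    q * q + t             ∎
    where open ≡.≡-Reasoning
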